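{- (Soundness.) For each service algebra $\mathfrak A$ and each asserted instruction sequence $\phi$: if $\mathrm{Th}(\mathfrak A)\vdash\phi$ then $\mathfrak A\models\phi$.
   Context: STANDING DEFINITIONS. Fix a set $\mathcal F$ of foci and a set $\mathcal M$ of methods; the basic instructions are $f.m$ with $f\in\mathcal F$, $m\in\mathcal M$. Primitive instructions: for each basic instruction $a$, the plain instruction $a$, the positive test $+a$ and the negative test $-a$; for each $l\in\mathbb N$ the forward jump $\#l$; and the termination instruction $!$. $\mathcal T$ is the set of closed terms built from primitive instructions (as constants) with binary concatenation $S_1;S_2$ and unary repetition $S^\omega$. A closed term denotes a nonempty finite or eventually periodic infinite sequence of primitive instructions: $;$ is concatenation and $S^\omega$ is $S$ concatenated infinitely often with itself (equal to $S$ if $S$ is infinite). $\mathrm{len}(S)\in\mathbb N\cup\{\omega\}$ is the length of the denoted sequence ($n<\omega$ for all $n$). For $n \in \mathbb N$: $S^0=\#0$, $S^1=S$, $S^{n+2}=S;S^{n+1}$. Threads: $\mathsf D$ (inaction), $\mathsf S$ (termination), and for each basic instruction (action) $a$ the postconditional composition $x\trianglelefteq a\trianglerighteq y$ (perform $a$, then behave as $x$ if the reply is true and as $y$ if it is false); $a\circ x$ abbreviates $x\trianglelefteq a\trianglerighteq x$. Threads are interpreted in the projective limit model (recursion equations have unique solutions). Thread extraction $|\cdot|$ is determined by: $|a|=a\circ\mathsf D$, $|a;X|=a\circ|X|$, $|+a|=a\circ\mathsf D$, $|+a;X|=|X|\trianglelefteq a\trianglerighteq|\#2;X|$, $|-a|=a\circ\mathsf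 D$, $|-a;X|=|\#2;X|\trianglelefteq a\trianglerighteq|X|$, $|\#l|=\mathsf D$, $|\#0;X|=\mathsf D$, $|\#1;X|=|X|$, $|\#(l{+}2);u|=\mathsf D$, $|\#(l{+}2);u;X|=|\#(l{+}1);X|$, $|!|=\mathsf S$, $|!;X|=\mathsf S$ ($u$ any primitive instruction), and $|X|=\mathsf D$ if $X$ has an infinite chain of forward jumps starting at its first instruction. Service algebras: a signature $\Sigma$ containing sorts $\mathbf{Serv}$, $\mathbf{Repl}$, constants $\delta:\mathbf{Serv}$ (empty service) and $\mathsf t,\mathsf f,\mathsf d:\mathbf{Repl}$, and for each $m\in\mathcal M$ operators $\partial_m:\mathbf{Serv}\to\mathbf{Serv}$ (derived service) and $\rho_m:\mathbf{Serv}\to\mathbf{Repl}$ (reply). A service algebra is a minimal $\Sigma$-algebra $\mathfrak A$ in which $\mathsf t,\mathsf f,\mathsf d$ are pairwise distinct, $(\bigwedge_{m\in\mathcal M}\partial_m(z)=z\wedge\rho_m(z)=\mathsf d)\to z=\delta$ holds, and $\partial_m(z)=\delta\leftrightarrow\rho_m(z)=\mathsf d$ holds for each $m$. Service families (sort $\mathbf{SF}$): constant $\emptyset$, $f.s$ for $f\in\mathcal F$ and $s$ of sort $\mathbf{Serv}$, composition $u\oplus v$, encapsulation $\partial_F(u)$ for $F\subseteq\mathcal F$, with axioms $u\oplus\emptyset=u$, $u\oplus v=v\oplus u$, $(u\oplus v)\oplus w=u\oplus(v\oplus w)$, $f.z\oplus f.z'=f.\delta$, $\partial_F(\emptyset)=\emptyset$,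 $\partial_F(f.z)=\emptyset$ if $f\in F$, $\partial_F(f.z)=f.z$ if $f\notin F$, $\partial_F(u\oplus v)=\partial_F(u)\oplus\partial_F(v)$. Apply operator $x\bullet u$ (thread, service family $\to$ service family): $\mathsf S\bullet u=u$; $\mathsf D\bullet u=\emptyset$; $(x\trianglelefteq f.m\trianglerighteq y)\bullet\partial_{\{f\}}(u)=\emptyset$; $(x\trianglelefteq f.m\trianglerighteq y)\bullet(f.s\oplus\partial_{\{f\}}(u))$ equals $x\bullet(f.\partial_m(s)\oplus\partial_{\{f\}}(u))$ if $\rho_m(s)=\mathsf t$, equals $y\bullet(f.\partial_m(s)\oplus\partial_{\{f\}}(u))$ if $\rho_m(s)=\mathsf f$, and equals $\emptyset$ if $\rho_m(s)=\mathsf d$. $\mathfrak A^*$ denotes the model of the combined theory (instruction sequences, threads, service families, thread extraction, apply) whose reducts are the initial model of instruction sequences, the projective limit model of threads, and the free extension of $\mathfrak A$ to a model of the service family axioms. Assertions: $\mathcal L(\mathfrak A)$ is the many-sorted first-order language with equality over $\Sigma$ whose free variables of sort $\mathbf{Serv}$ are foci. $\mathrm{vars}(P)$ is the set of foci free in $P$; $\mathrm{vars}(S)$ is the set of foci occurring in $S$. For finite $F\subseteq\mathcal F$, a state representing term for $F$ is a closed $\mathbf{SF}$-term $t$ such that for each $f\in F$, $\partial_{\{f\}}(t)=t$ does not hold in the free extension of $\mathfrak A$ (i.e. $t$ contains a service named $f$); a state representing term for $P$ (resp. $S$) is one for $\mathrm{vars}(P)$ (resp. $\mathrm{vars}(S)$).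 $P[t]$ is $P$ with each free focus $f$ replaced by a closed $\mathbf{Serv}$-term $t'$ with $t=f.t'\oplus\partial_{\{f\}}(t)$. $P[s/x]$ denotes substitution of $s$ for free $x$. $|S|_{b,0}=|\#b;S|$ and, for $e>0$, $|S|_{b,e}=|\#b;S;\sigma(e)|$ where $\sigma(1)=!$ and $\sigma(n+1)=\#0;\sigma(n)$. Asserted instruction sequences: $\{b{:}P\}\,S\,\{e{:}Q\}$ with $S\in\mathcal T$, $P,Q\in\mathcal L(\mathfrak A)$, $b\in\mathbb N^+=\{n\in\mathbb N: n>0\}$, $e\in\mathbb N$. It holds in $\mathfrak A$, written $\mathfrak A\models\{b{:}P\}\,S\,\{e{:}Q\}$, iff $b\le\mathrm{len}(S)$ and for all closed $\mathbf{SF}$-terms $t,t'$ that are state representing terms for $P$, for $Q$ and for $S$: if $\mathfrak A\models P[t]$ then $\mathfrak A^*\models|S|_{b,e'}\bullet t=\emptyset$ for every $e'\in\mathbb N$ with $e'\neq e$; and if $\mathfrak A\models P[t]$ and $\mathfrak A^*\models|S|_{b,e}\bullet t=t'$ then $\mathfrak A\models Q[t']$. Proof system (with $\mathsf{true},\mathsf{false}$ the logical constants): A1 $\{1{:}\rho_m(f)\ne\mathsf d\wedge P[\partial_m(f)/f]\}\,f.m\,\{1{:}P\}$; A2 $\{1{:}\rho_m(f)=\mathsf d\}\,f.m\,\{0{:}\mathsf{false}\}$; A3 $\{1{:}\rho_m(f)=\mathsf t\wedge P[\partial_m(f)/f]\}\,{+}f.m\,\{1{:}P\}$; A4 $\{1{:}\rho_m(f)=\mathsf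 f\wedge P[\partial_m(f)/f]\}\,{+}f.m\,\{2{:}P\}$; A5 $\{1{:}\rho_m(f)=\mathsf d\}\,{+}f.m\,\{0{:}\mathsf{false}\}$; A6 $\{1{:}\rho_m(f)=\mathsf t\wedge P[\partial_m(f)/f]\}\,{ - }f.m\,\{2{:}P\}$; A7 $\{1{:}\rho_m(f)=\mathsf f\wedge P[\partial_m(f)/f]\}\,{ - }f.m\,\{1{:}P\}$; A8 $\{1{:}\rho_m(f)=\mathsf d\}\,{ - }f.m\,\{0{:}\mathsf{false}\}$; A9 $\{1{:}P\}\,\#(i{+}1)\,\{i{+}1{:}P\}$; A10 $\{1{:}\mathsf{true}\}\,\#0\,\{0{:}\mathsf{false}\}$; A11 $\{1{:}P\}\,!\,\{0{:}P\}$. R1: from $\{b{:}P\}S_1\{i{:}Q\}$ and $\{i{:}Q\}S_2\{e{:}R\}$ with $i>0$ infer $\{b{:}P\}S_1;S_2\{e{:}R\}$. R2: from $\{b{:}P\}S_1\{e{+}\mathrm{len}(S_2){:}Q\}$ with $e>0$ infer $\{b{:}P\}S_1;S_2\{e{:}Q\}$. R3: from $\{b{:}P\}S_1\{0{:}Q\}$ infer $\{b{:}P\}S_1;S_2\{0{:}Q\}$. R4: from $\{b{:}P\}S_2\{e{:}Q\}$ infer $\{b{+}\mathrm{len}(S_1){:}P\}S_1;S_2\{e{:}Q\}$. R5 (for each $k\le n$, $n>0$): if for every $j\in\{1,\dots,n\}$, $\{b_1{:}P_1\}S^\omega\{0{:}Q_1\},\dots,\{b_n{:}P_n\}S^\omega\{0{:}Q_n\}\vdash'\{b_j{:}P_j\}S;S^\omega\{0{:}Q_j\}$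 (together with the ambient hypotheses), infer $\{b_k{:}P_k\}S^\omega\{0{:}Q_k\}$. R6: from $\{b{:}P\}S\{e{:}R\}$ and $\{b{:}Q\}S\{e{:}R\}$ infer $\{b{:}P\vee Q\}S\{e{:}R\}$. R7: from $\{b{:}P\}S\{e{:}Q\}$ infer $\{b{:}P\wedge R\}S\{e{:}Q\wedge R\}$ if $\mathrm{vars}(R)\cap\mathrm{vars}(S)=\emptyset$. R8: from $\{b{:}P\}S\{e{:}Q\}$ infer $\{b{:}\exists x P\}S\{e{:}Q\}$ if $x\notin\mathrm{vars}(S)\cup\mathrm{vars}(Q)$. R9: from $\{b{:}P\}S\{e{:}Q\}$ infer $\{b{:}P[y/x]\}S\{e{:}Q[y/x]\}$ if $x,y\notin\mathrm{vars}(S)$. R10: from $P\to P'$, $\{b{:}P'\}S\{e{:}Q'\}$, $Q'\to Q$ infer $\{b{:}P\}S\{e{:}Q\}$. ($x,y$ range over variables of sorts of $\Sigma$.) $\Gamma\vdash\phi$ means $\phi$ is derivable using formulas of $\Gamma$ (formulas of $\mathcal L(\mathfrak A)$ serving as premises of R10, and asserted instruction sequences) as hypotheses; $\Gamma\vdash'\phi$ means derivable without using R5. $\mathrm{Th}(\mathfrak A)$ is the set of formulas of $\mathcal L(\mathfrak A)$ true in $\mathfrak A$.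
   Formalization: As literally defined, A11 and A10 are unsound; so for e=0 the first clause asks |S|_{b,e'}•t = |S|_{b,0}•t instead of ∅, and t' must not equal ∅. Sorts are nonempty, foci, sorts and replies have decidable equality, R8 reads vars(Q) as all free variables, other replies act as d. -}

module Defs where

open import Data.Bool using (Bool; true; false; if_then_else_)
open import Data.Empty using (⊥)
open import Data.Fin using (Fin)
open import Data.List using (List; []; _∷_; _++_; length)
open import Data.List.Membership.Propositional using (_∈_; _∉_)
open import Data.List.NonEmpty as List⁺ using (List⁺; _∷_; _⁺++⁺_)
open import Data.List.Relation.Binary.Disjoint.Propositional using (Disjoint)
open import Data.List.Relation.Unary.All as All using (All; []; _∷_)
open import Data.List.Relation.Unary.Any using (here; there)
open import Data.Maybe using (Maybe; just; nothing; _>>=_)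
open import Data.Nat using (ℕ; zero; suc; _+_; _≤_; NonZero)
import Data.Nat.Properties as ℕ
open import Data.Product using (Σ; ∃; _×_; _,_)
import Data.Product.Properties as Product
open import Data.Sum using (_⊎_; inj₁; inj₂; [_,_]′)
open import Data.Unit using (⊤)
open import Function using (_∘_; _⇔_)
open import Level using (0ℓ)
open import Relation.Binary.Definitions using (DecidableEquality)
open import Relation.Binary.PropositionalEquality using (_≡_; _≢_; refl; cong; cong₂)
open import Relation.Nullary using (¬_; yes; no)
open import Relation.Nullary.Decidable using (⌊_⌋)
open import Relation.Unary using (Pred; _∪_)

data SortOver (E : Set) : Set where
  serv repl : SortOver E
  extra     : E → SortOver E

-- The sorts and operators that Σ may have in addition to the mandatory ones,
-- which are built into `Sort` and `Op` below.
record Signature : Set₁ where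
  field
    ExtraSort : Set
    _≟ᴱ_      : DecidableEquality ExtraSort
    ExtraOp   : List (SortOver ExtraSort) → SortOver ExtraSort → Set

module Logic (Focus Method : Set) (_≟ᶠ_ : DecidableEquality Focus) (Sg : Signature) where

  open Signature Sg

  data Basic : Set where
    _∙_ : Focus → Method → Basic

  data Instr : Set where
    plain pos neg : Basic → Instr
    #_            : ℕ → Instr
    !             : Instr

  infixr 5 _⨾_
  infix  6 _^ω

  data 𝒯 : Set where
    ⟨_⟩ : Instr → 𝒯
    _⨾_ : 𝒯 → 𝒯 → 𝒯
    _^ω : 𝒯 → 𝒯

  -- `fin xs` is the finite sequence xs, `lasso us vs` is us followed by vs
  -- repeated forever.
  data Seq : Set where
    fin   : List⁺ Instr → Seq
    lasso : List Instr → List⁺ Instr → Seq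

  infixr 5 _++ˢ_

  _++ˢ_ : Seq → Seq → Seq
  fin xs      ++ˢ fin ys      = fin (xs ⁺++⁺ ys)
  fin xs      ++ˢ lasso us vs = lasso (List⁺.toList xs ++ us) vs
  lasso us vs ++ˢ _           = lasso us vs

  repeat : Seq → Seq
  repeat (fin xs)      = lasso [] xs
  repeat (lasso us vs) = lasso us vs

  ⟦_⟧ : 𝒯 → Seq
  ⟦ ⟨ u ⟩ ⟧ = fin (u ∷ [])
  ⟦ S ⨾ T ⟧ = ⟦ S ⟧ ++ˢ ⟦ T ⟧
  ⟦ S ^ω ⟧  = repeat ⟦ S ⟧

  data Length : Set where
    finite : ℕ → Length
    ω      : Length

  infix 4 _≤ᴸ_

  _≤ᴸ_ : ℕ → Length → Set
  b ≤ᴸ finite n = b ≤ n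
  b ≤ᴸ ω        = ⊤

  len : 𝒯 → Length
  len S with ⟦ S ⟧
  ... | fin xs    = finite (List⁺.length xs)
  ... | lasso _ _ = ω

  data FinThread : Set where
    𝐒 𝐃   : FinThread
    _⊴_⊵_ : FinThread → Basic → FinThread → FinThread

  π : ℕ → FinThread → FinThread
  π zero    x           = 𝐃
  π (suc n) 𝐒           = 𝐒
  π (suc n) 𝐃           = 𝐃
  π (suc n) (x ⊴ a ⊵ y) = π n x ⊴ a ⊵ π n y

  -- The projective limit of the finite threads of bounded depth along π.
  record Thread : Set where
    field
      approx   : ℕ → FinThread
      coherent : ∀ n → π n (approx (suc n)) ≡ approx n

  open Thread public

  first : Seq → Instr
  first (fin (x ∷ _))           = x
  first (lasso [] (v ∷ _))      = v
  first (lasso (u ∷ _) _)       = u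

  -- `nothing` if the first instruction is also the last one.
  rest : Seq → Maybe Seq
  rest (fin (x ∷ []))       = nothing
  rest (fin (x ∷ y ∷ ys))   = just (fin (y ∷ ys))
  rest (lasso [] (v ∷ vs))  = just (lasso vs (v ∷ vs))
  rest (lasso (u ∷ us) vs)  = just (lasso us vs)

  -- The equations for |#l| and |#l;X|: the sequence from which execution
  -- continues, `nothing` standing for a sequence whose thread is D.
  jump : ℕ → Maybe Seq → Maybe Seq
  jump zero          _        = nothing
  jump (suc _)       nothing  = nothing
  jump (suc zero)    (just X) = just X
  jump (suc (suc l)) (just X) = jump (suc l) (rest X)

  settle : ℕ → Seq → Maybe Seq
  settle k X with first X | k
  ... | # l | zero   = nothing
  ... | # l | suc k′ = jump l (rest X) >>= settle k′
  ... | _   | _      = just X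

  -- An upper bound on the number of distinct suffixes of X.  A chain of more
  -- than that many jumps visits some suffix twice, and so is infinite.
  size : Seq → ℕ
  size (fin xs)      = List⁺.length xs
  size (lasso us vs) = length us + List⁺.length vs

  settled : Maybe Seq → Maybe Seq
  settled mX = mX >>= λ X → settle (size X) X

  -- The projections πₙ of the extracted thread.
  mutual
    extract : ℕ → Maybe Seq → FinThread
    extract zero    _  = 𝐃
    extract (suc n) mX = step n (settled mX)

    step : ℕ → Maybe Seq → FinThread
    step n nothing  = 𝐃
    step n (just X) = perform n (first X) (rest X)

    perform : ℕ → Instr → Maybe Seq → FinThread
    perform n (plain a) X = extract n X ⊴ a ⊵ extract n X
    perform n (pos a)   X = extract n X ⊴ a ⊵ extract n (jump 2 X)
    perform n (neg a)   X = extract n (jump 2 X) ⊴ a ⊵ extract n X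
    perform n (# l)     X = 𝐃   -- does not occur: `settled` skips jumps
    perform n !         X = 𝐒

  mutual
    extract-coherent : ∀ n mX → π n (extract (suc n) mX) ≡ extract n mX
    extract-coherent zero    mX = refl
    extract-coherent (suc n) mX = step-coherent n (settled mX)

    step-coherent : ∀ n mX → π (suc n) (step (suc n) mX) ≡ step n mX
    step-coherent n nothing  = refl
    step-coherent n (just X) = perform-coherent n (first X) (rest X)

    perform-coherent : ∀ n u X → π (suc n) (perform (suc n) u X) ≡ perform n u X
    perform-coherent n (plain a) X =
      cong (λ x → x ⊴ a ⊵ x) (extract-coherent n X)
    perform-coherent n (pos a) X =
      cong₂ (λ x y → x ⊴ a ⊵ y) (extract-coherent n X) (extract-coherent n (jump 2 X))
    perform-coherent n (neg a) X =
      cong₂ (λ x y → x ⊴ a ⊵ y) (extract-coherent n (jump 2 X)) (extract-coherent n X)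
    perform-coherent n (# l) X = refl
    perform-coherent n !     X = refl

  ∣_∣ : 𝒯 → Thread
  ∣ S ∣ = record
    { approx   = λ n → extract n (just ⟦ S ⟧)
    ; coherent = λ n → extract-coherent n (just ⟦ S ⟧)
    }

  -- σ[1+ n ] is σ(n+1)
  σ[1+_] : ℕ → 𝒯
  σ[1+ zero ]  = ⟨ ! ⟩
  σ[1+ suc n ] = ⟨ # 0 ⟩ ⨾ σ[1+ n ]

  ∣_∣[_,_] : 𝒯 → ℕ → ℕ → Thread
  ∣ S ∣[ b , zero ]  = ∣ ⟨ # b ⟩ ⨾ S ∣
  ∣ S ∣[ b , suc e ] = ∣ ⟨ # b ⟩ ⨾ S ⨾ σ[1+ e ] ∣

  Sort : Set
  Sort = SortOver ExtraSort

  _≟ˢ_ : DecidableEquality Sort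
  serv    ≟ˢ serv    = yes refl
  serv    ≟ˢ repl    = no λ ()
  serv    ≟ˢ extra _ = no λ ()
  repl    ≟ˢ serv    = no λ ()
  repl    ≟ˢ repl    = yes refl
  repl    ≟ˢ extra _ = no λ ()
  extra _ ≟ˢ serv    = no λ ()
  extra _ ≟ˢ repl    = no λ ()
  extra i ≟ˢ extra j with i ≟ᴱ j
  ... | yes refl = yes refl
  ... | no  i≢j  = no λ { refl → i≢j refl }

  data Op : List Sort → Sort → Set where
    δ        : Op [] serv
    𝗍 𝖿 𝖽    : Op [] repl
    ∂        : Method → Op (serv ∷ []) serv
    ρ        : Method → Op (serv ∷ []) repl
    extraOp  : ∀ {ss s} → ExtraOp ss s → Op ss s

  data Tm (V : Sort → Set) : Sort → Set where
    var : ∀ {s} → V s → Tm V s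
    op  : ∀ {ss s} → Op ss s → All (Tm V) ss → Tm V s

  Closed : Sort → Set
  Closed = Tm (λ _ → ⊥)

  module _ {V W : Sort → Set} (θ : ∀ {s} → V s → Tm W s) where
    mutual
      bind : ∀ {s} → Tm V s → Tm W s
      bind (var x)   = θ x
      bind (op o us) = op o (binds us)

      binds : ∀ {ss} → All (Tm V) ss → All (Tm W) ss
      binds []       = []
      binds (u ∷ us) = bind u ∷ binds us

  Var : Sort → Set
  Var serv      = Focus
  Var repl      = ℕ
  Var (extra _) = ℕ

  _≟ᵛ_ : ∀ {s} → DecidableEquality (Var s)
  _≟ᵛ_ {serv}    = _≟ᶠ_
  _≟ᵛ_ {repl}    = ℕ._≟_
  _≟ᵛ_ {extra _} = ℕ._≟_

  Variable : Set
  Variable = Σ Sort Var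

  _≟_ : DecidableEquality Variable
  _≟_ = Product.≡-dec _≟ˢ_ _≟ᵛ_

  -- Free variables are named and bound variables are de Bruijn indices into
  -- Γ, so substitution for free variables cannot capture.
  Scope : List Sort → Sort → Set
  Scope Γ s = Var s ⊎ s ∈ Γ

  infix  8 _≐_
  infix  7 ¬ᶠ_
  infixr 6 _∧_
  infixr 5 _∨_
  infixr 4 _⇒_

  data Fm (Γ : List Sort) : Set where
    ⊤ᶠ ⊥ᶠ       : Fm Γ
    _≐_         : ∀ {s} → Tm (Scope Γ) s → Tm (Scope Γ) s → Fm Γ
    ¬ᶠ_         : Fm Γ → Fm Γ
    _∧_ _∨_ _⇒_ : Fm Γ → Fm Γ → Fm Γ
    all ex      : ∀ s → Fm (s ∷ Γ) → Fm Γ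

  Formula : Set
  Formula = Fm []

  free : ∀ {s} → Var s → Tm (Scope []) s
  free = var ∘ inj₁

  weaken : ∀ {Γ r s} → Tm (Scope Γ) s → Tm (Scope (r ∷ Γ)) s
  weaken = bind [ var ∘ inj₁ , var ∘ inj₂ ∘ there ]′

  lift : ∀ {Γ Δ r} → (∀ {s} → Scope Γ s → Tm (Scope Δ) s) →
         ∀ {s} → Scope (r ∷ Γ) s → Tm (Scope (r ∷ Δ)) s
  lift θ (inj₁ x)           = weaken (θ (inj₁ x))
  lift θ (inj₂ (here s≡r))  = var (inj₂ (here s≡r))
  lift θ (inj₂ (there i))   = weaken (θ (inj₂ i))

  bindᶠ : ∀ {Γ Δ} → (∀ {s} → Scope Γ s → Tm (Scope Δ) s) → Fm Γ → Fm Δ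
  bindᶠ θ ⊤ᶠ        = ⊤ᶠ
  bindᶠ θ ⊥ᶠ        = ⊥ᶠ
  bindᶠ θ (u ≐ v)   = bind θ u ≐ bind θ v
  bindᶠ θ (¬ᶠ P)    = ¬ᶠ bindᶠ θ P
  bindᶠ θ (P ∧ Q)   = bindᶠ θ P ∧ bindᶠ θ Q
  bindᶠ θ (P ∨ Q)   = bindᶠ θ P ∨ bindᶠ θ Q
  bindᶠ θ (P ⇒ Q)   = bindᶠ θ P ⇒ bindᶠ θ Q
  bindᶠ θ (all s P) = all s (bindᶠ (lift θ) P)
  bindᶠ θ (ex s P)  = ex s (bindᶠ (lift θ) P)

  replace : ∀ {Γ r} → Tm (Scope Γ) r → Var r → ∀ {s} → Scope Γ s → Tm (Scope Γ) s
  replace {r = r} u x {s} (inj₁ y) with (r , x) ≟ (s , y)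
  ... | yes refl = u
  ... | no  _    = var (inj₁ y)
  replace u x (inj₂ i) = var (inj₂ i)

  infix 9 _[_/_]

  _[_/_] : ∀ {Γ s} → Fm Γ → Tm (Scope Γ) s → Var s → Fm Γ
  P [ u / x ] = bindᶠ (replace u x) P

  -- ∃x P for a named variable x.
  exists : ∀ {s} → Var s → Formula → Formula
  exists {s} x P =
    ex s (bindᶠ [ var ∘ inj₁ , var ∘ inj₂ ∘ there ]′ P [ var (inj₂ (here refl)) / x ])

  mutual
    varsᵗ : ∀ {Γ s} → Tm (Scope Γ) s → List Variable
    varsᵗ {s = s} (var (inj₁ x)) = (s , x) ∷ []
    varsᵗ (var (inj₂ _))         = []
    varsᵗ (op _ us)              = varsᵗˢ us

    varsᵗˢ : ∀ {Γ ss} → All (Tm (Scope Γ)) ss → List Variable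
    varsᵗˢ []       = []
    varsᵗˢ (u ∷ us) = varsᵗ u ++ varsᵗˢ us

  -- All free variables; vars(P) consists of those of sort Serv.
  varsᶠ : ∀ {Γ} → Fm Γ → List Variable
  varsᶠ ⊤ᶠ        = []
  varsᶠ ⊥ᶠ        = []
  varsᶠ (u ≐ v)   = varsᵗ u ++ varsᵗ v
  varsᶠ (¬ᶠ P)    = varsᶠ P
  varsᶠ (P ∧ Q)   = varsᶠ P ++ varsᶠ Q
  varsᶠ (P ∨ Q)   = varsᶠ P ++ varsᶠ Q
  varsᶠ (P ⇒ Q)   = varsᶠ P ++ varsᶠ Q
  varsᶠ (all s P) = varsᶠ P
  varsᶠ (ex s P)  = varsᶠ P

  varsᵇ : Basic → List Variable
  varsᵇ (f ∙ m) = (serv , f) ∷ []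

  varsⁱ : Instr → List Variable
  varsⁱ (plain a) = varsᵇ a
  varsⁱ (pos a)   = varsᵇ a
  varsⁱ (neg a)   = varsᵇ a
  varsⁱ (# l)     = []
  varsⁱ !         = []

  vars : 𝒯 → List Variable
  vars ⟨ u ⟩   = varsⁱ u
  vars (S ⨾ T) = vars S ++ vars T
  vars (S ^ω)  = vars S

  record Algebra : Set₁ where
    field
      Carrier   : Sort → Set
      interpret : ∀ {ss s} → Op ss s → All Carrier ss → Carrier s

    module _ {V : Sort → Set} (v : ∀ s → V s → Carrier s) where
      mutual
        eval : ∀ {s} → Tm V s → Carrier s
        eval {s} (var x) = v s x
        eval (op o us)   = interpret o (evals us)

        evals : ∀ {ss} → All (Tm V) ss → All Carrier ss
        evals []       = []
        evals (u ∷ us) = eval u ∷ evals us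

    value : ∀ {s} → Closed s → Carrier s
    value = eval (λ _ ())

    Valuation : Set
    Valuation = ∀ s → Var s → Carrier s

    scoped : ∀ {Γ} → Valuation → All Carrier Γ → ∀ s → Scope Γ s → Carrier s
    scoped v γ s = [ v s , All.lookup γ ]′

    Sat : ∀ {Γ} → Valuation → All Carrier Γ → Fm Γ → Set
    Sat v γ ⊤ᶠ        = ⊤
    Sat v γ ⊥ᶠ        = ⊥
    Sat v γ (t ≐ u)   = eval (scoped v γ) t ≡ eval (scoped v γ) u
    Sat v γ (¬ᶠ P)    = ¬ Sat v γ P
    Sat v γ (P ∧ Q)   = Sat v γ P × Sat v γ Q
    Sat v γ (P ∨ Q)   = Sat v γ P ⊎ Sat v γ Q
    Sat v γ (P ⇒ Q)   = Sat v γ P → Sat v γ Q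
    Sat v γ (all s P) = (a : Carrier s) → Sat v (a ∷ γ) P
    Sat v γ (ex s P)  = Σ (Carrier s) λ a → Sat v (a ∷ γ) P

    δᴬ : Carrier serv
    δᴬ = interpret δ []

    tᴬ fᴬ dᴬ : Carrier repl
    tᴬ = interpret 𝗍 []
    fᴬ = interpret 𝖿 []
    dᴬ = interpret 𝖽 []

    ∂ᴬ : Method → Carrier serv → Carrier serv
    ∂ᴬ m z = interpret (∂ m) (z ∷ [])

    ρᴬ : Method → Carrier serv → Carrier repl
    ρᴬ m z = interpret (ρ m) (z ∷ [])

  record ServiceAlgebra : Set₁ where
    field
      algebra : Algebra
    open Algebra algebra public
    field
      minimal   : ∀ s (a : Carrier s) → Σ (Closed s) λ c → value c ≡ a
      t≢f       : tᴬ ≢ fᴬ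
      t≢d       : tᴬ ≢ dᴬ
      f≢d       : fᴬ ≢ dᴬ
      inert     : ∀ z → (∀ m → ∂ᴬ m z ≡ z × ρᴬ m z ≡ dᴬ) → z ≡ δᴬ
      rejecting : ∀ m z → (∂ᴬ m z ≡ δᴬ) ⇔ (ρᴬ m z ≡ dᴬ)
      -- The usual proviso of many-sorted first-order logic.
      inhabited : ∀ s → Carrier s
      -- Classically void; makes the apply operator a function.
      _≟ʳ_      : DecidableEquality (Carrier repl)

  infix 3 _⊨_

  _⊨_ : ServiceAlgebra → Formula → Set
  𝔄 ⊨ P = ∀ v → Sat v [] P
    where open ServiceAlgebra 𝔄

  infixr 6 _⊕_

  data SF : Set where
    ∅    : SF
    _∙_  : Focus → Closed serv → SF
    _⊕_  : SF → SF → SF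
    encap : (Focus → Bool) → SF → SF

  ｛_｝ : Focus → Focus → Bool
  ｛ f ｝ g = ⌊ f ≟ᶠ g ⌋

  both : Maybe (Closed serv) → Maybe (Closed serv) → Maybe (Closed serv)
  both nothing  z        = z
  both (just s) nothing  = just s
  both (just _) (just _) = just (op δ [])

  -- The closed term s with t = f.s ⊕ ∂_{f}(t), or `nothing` if
  -- t = ∂_{f}(t).
  service : Focus → SF → Maybe (Closed serv)
  service f ∅           = nothing
  service f (g ∙ s)     = if ⌊ f ≟ᶠ g ⌋ then just s else nothing
  service f (u ⊕ v)     = both (service f u) (service f v)
  service f (encap F u) = if F f then nothing else service f u

  open-closed : ∀ {s} → Closed s → Tm (Scope []) s
  open-closed = bind λ ()

  instantiate : SF → ∀ {s} → Scope [] s → Tm (Scope []) s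
  instantiate t {serv} (inj₁ f) with service f t
  ... | just s  = open-closed s
  ... | nothing = free {serv} f
  instantiate t {repl}    (inj₁ x) = free {repl} x
  instantiate t {extra i} (inj₁ x) = free {extra i} x

  infix 9 _[_]

  _[_] : Formula → SF → Formula
  P [ t ] = bindᶠ (instantiate t) P

  module Families (𝔄 : ServiceAlgebra) where

    open ServiceAlgebra 𝔄

    infix 4 _≈_

    -- Equality in the free extension of 𝔄.
    data _≈_ : SF → SF → Set where
      ≈-refl   : ∀ {u} → u ≈ u
      ≈-sym    : ∀ {u v} → u ≈ v → v ≈ u
      ≈-trans  : ∀ {u v w} → u ≈ v → v ≈ w → u ≈ w
      ∙-cong   : ∀ {f s s′} → value s ≡ value s′ → f ∙ s ≈ f ∙ s′
      ⊕-cong   : ∀ {u u′ v v′} → u ≈ u′ → v ≈ v′ → u ⊕ v ≈ u′ ⊕ v′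
      ∂-cong   : ∀ {F u u′} → u ≈ u′ → encap F u ≈ encap F u′
      ⊕-∅      : ∀ {u} → u ⊕ ∅ ≈ u
      ⊕-comm   : ∀ {u v} → u ⊕ v ≈ v ⊕ u
      ⊕-assoc  : ∀ {u v w} → (u ⊕ v) ⊕ w ≈ u ⊕ (v ⊕ w)
      ⊕-clash  : ∀ {f s s′} → f ∙ s ⊕ f ∙ s′ ≈ f ∙ op δ []
      ∂-∅      : ∀ {F} → encap F ∅ ≈ ∅
      ∂-in     : ∀ {F f s} → F f ≡ true → encap F (f ∙ s) ≈ ∅
      ∂-out    : ∀ {F f s} → F f ≡ false → encap F (f ∙ s) ≈ f ∙ s
      ∂-⊕      : ∀ {F u v} → encap F (u ⊕ v) ≈ encap F u ⊕ encap F v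

    infixr 7 _•_

    -- The equations leave x • u open for a reply other than t, f and d, which
    -- 𝔄 need not exclude; such a reply is treated like d.
    _•_ : FinThread → SF → SF
    𝐒 • u = u
    𝐃 • u = ∅
    (x ⊴ f ∙ m ⊵ y) • u with service f u
    ... | nothing = ∅
    ... | just s with ρᴬ m (value s) ≟ʳ tᴬ | ρᴬ m (value s) ≟ʳ fᴬ
    ...   | yes _ | _     = x • (f ∙ op (∂ m) (s ∷ []) ⊕ encap ｛ f ｝ u)
    ...   | no _  | yes _ = y • (f ∙ op (∂ m) (s ∷ []) ⊕ encap ｛ f ｝ u)
    ...   | no _  | no _  = ∅

    infix 4 _•_≋_

    -- 𝔄* ⊨ x • u = v: the value of x • u is the limit of those of πₙ(x) • u,
    -- which are ∅ until, possibly, termination is reached.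
    _•_≋_ : Thread → SF → SF → Set
    x • u ≋ v = ∃ λ N → ∀ n → N ≤ n → approx x n • u ≈ v

    StateRepresenting : List Variable → SF → Set
    StateRepresenting F t = ∀ f → (serv , f) ∈ F → ¬ (encap ｛ f ｝ t ≈ t)

  infix 2 ⟨_∶_⟩_⟨_∶_⟩

  data Asserted : Set where
    ⟨_∶_⟩_⟨_∶_⟩ : (b : ℕ) .{{_ : NonZero b}} → Formula → 𝒯 → ℕ → Formula → Asserted

  module _ (𝔄 : ServiceAlgebra) where

    open Families 𝔄

    -- Execution of S from position b in state t does not leave S other than
    -- through e.  For e = 0 the demand |S|_{b,e′} • t = ∅ would also forbid
    -- termination inside S, which is what e = 0 stands for; so there only an
    -- effect of the exit e′ on the result is forbidden.
    OnlyExit : 𝒯 → ℕ → SF → ℕ → Set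
    OnlyExit S b t e@(suc _) =
      ∀ e′ → e′ ≢ e → ∣ S ∣[ b , e′ ] • t ≋ ∅
    OnlyExit S b t zero =
      ∀ e′ → e′ ≢ 0 → ∀ u → (∣ S ∣[ b , e′ ] • t ≋ u) ⇔ (∣ S ∣[ b , 0 ] • t ≋ u)

    -- The result ∅ is what inaction yields, so it is not a final state.
    Holds : Asserted → Set
    Holds (⟨ b ∶ P ⟩ S ⟨ e ∶ Q ⟩) =
      b ≤ᴸ len S ×
      (∀ t t′ →
        StateRepresenting (varsᶠ P) t  → StateRepresenting (varsᶠ Q) t  → StateRepresenting (vars S) t  →
        StateRepresenting (varsᶠ P) t′ → StateRepresenting (varsᶠ Q) t′ → StateRepresenting (vars S) t′ →
        (𝔄 ⊨ P [ t ] → OnlyExit S b t e) ×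
        (𝔄 ⊨ P [ t ] → ∣ S ∣[ b , e ] • t ≋ t′ → ¬ (t′ ≈ ∅) → 𝔄 ⊨ Q [ t′ ]))

  infix 3 _⊨ᵃ_

  _⊨ᵃ_ : ServiceAlgebra → Asserted → Set
  𝔄 ⊨ᵃ φ = Holds 𝔄 φ

  data Hypothesis : Set where
    formula  : Formula → Hypothesis
    asserted : Asserted → Hypothesis

  Th : ServiceAlgebra → Pred Hypothesis 0ℓ
  Th 𝔄 (formula P)  = 𝔄 ⊨ P
  Th 𝔄 (asserted _) = ⊥

  -- `noR5` is the restricted derivability ⊢′.
  data Mode : Set where
    full noR5 : Mode

  infix 3 _⊢[_]_ _⊢_

  ρ≐ : Method → Focus → Op [] repl → Formula
  ρ≐ m f r = op (ρ m) (free {serv} f ∷ []) ≐ op r []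

  after : Method → Focus → Formula → Formula
  after m f P = _[_/_] {s = serv} P (op (∂ m) (free {serv} f ∷ [])) f

  data _⊢[_]_ (Γ : Pred Hypothesis 0ℓ) : Mode → Asserted → Set where

    hyp : ∀ {μ φ} → Γ (asserted φ) → Γ ⊢[ μ ] φ

    A1  : ∀ {μ f m P} → Γ ⊢[ μ ] ⟨ 1 ∶ ¬ᶠ ρ≐ m f 𝖽 ∧ after m f P ⟩ ⟨ plain (f ∙ m) ⟩ ⟨ 1 ∶ P ⟩
    A2  : ∀ {μ f m} →   Γ ⊢[ μ ] ⟨ 1 ∶ ρ≐ m f 𝖽 ⟩ ⟨ plain (f ∙ m) ⟩ ⟨ 0 ∶ ⊥ᶠ ⟩
    A3  : ∀ {μ f m P} → Γ ⊢[ μ ] ⟨ 1 ∶ ρ≐ m f 𝗍 ∧ after m f P ⟩ ⟨ pos (f ∙ m) ⟩ ⟨ 1 ∶ P ⟩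
    A4  : ∀ {μ f m P} → Γ ⊢[ μ ] ⟨ 1 ∶ ρ≐ m f 𝖿 ∧ after m f P ⟩ ⟨ pos (f ∙ m) ⟩ ⟨ 2 ∶ P ⟩
    A5  : ∀ {μ f m} →   Γ ⊢[ μ ] ⟨ 1 ∶ ρ≐ m f 𝖽 ⟩ ⟨ pos (f ∙ m) ⟩ ⟨ 0 ∶ ⊥ᶠ ⟩
    A6  : ∀ {μ f m P} → Γ ⊢[ μ ] ⟨ 1 ∶ ρ≐ m f 𝗍 ∧ after m f P ⟩ ⟨ neg (f ∙ m) ⟩ ⟨ 2 ∶ P ⟩
    A7  : ∀ {μ f m P} → Γ ⊢[ μ ] ⟨ 1 ∶ ρ≐ m f 𝖿 ∧ after m f P ⟩ ⟨ neg (f ∙ m) ⟩ ⟨ 1 ∶ P ⟩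
    A8  : ∀ {μ f m} →   Γ ⊢[ μ ] ⟨ 1 ∶ ρ≐ m f 𝖽 ⟩ ⟨ neg (f ∙ m) ⟩ ⟨ 0 ∶ ⊥ᶠ ⟩
    A9  : ∀ {μ i P} →   Γ ⊢[ μ ] ⟨ 1 ∶ P ⟩ ⟨ # (suc i) ⟩ ⟨ suc i ∶ P ⟩
    A10 : ∀ {μ} →       Γ ⊢[ μ ] ⟨ 1 ∶ ⊤ᶠ ⟩ ⟨ # 0 ⟩ ⟨ 0 ∶ ⊥ᶠ ⟩
    A11 : ∀ {μ P} →     Γ ⊢[ μ ] ⟨ 1 ∶ P ⟩ ⟨ ! ⟩ ⟨ 0 ∶ P ⟩

    R1  : ∀ {μ b i e P Q R S₁ S₂} .{{_ : NonZero b}} .{{_ : NonZero i}} →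
          Γ ⊢[ μ ] ⟨ b ∶ P ⟩ S₁ ⟨ i ∶ Q ⟩ →
          Γ ⊢[ μ ] ⟨ i ∶ Q ⟩ S₂ ⟨ e ∶ R ⟩ →
          Γ ⊢[ μ ] ⟨ b ∶ P ⟩ S₁ ⨾ S₂ ⟨ e ∶ R ⟩

    R2  : ∀ {μ b e n P Q S₁ S₂} .{{_ : NonZero b}} .{{_ : NonZero e}} →
          len S₂ ≡ finite n →
          Γ ⊢[ μ ] ⟨ b ∶ P ⟩ S₁ ⟨ e + n ∶ Q ⟩ →
          Γ ⊢[ μ ] ⟨ b ∶ P ⟩ S₁ ⨾ S₂ ⟨ e ∶ Q ⟩

    R3  : ∀ {μ b P Q S₁ S₂} .{{_ : NonZero b}} →
          Γ ⊢[ μ ] ⟨ b ∶ P ⟩ S₁ ⟨ 0 ∶ Q ⟩ →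
          Γ ⊢[ μ ] ⟨ b ∶ P ⟩ S₁ ⨾ S₂ ⟨ 0 ∶ Q ⟩

    R4  : ∀ {μ b e n P Q S₁ S₂} .{{_ : NonZero b}} .{{_ : NonZero (b + n)}} →
          len S₁ ≡ finite n →
          Γ ⊢[ μ ] ⟨ b ∶ P ⟩ S₂ ⟨ e ∶ Q ⟩ →
          Γ ⊢[ μ ] ⟨ b + n ∶ P ⟩ S₁ ⨾ S₂ ⟨ e ∶ Q ⟩

    R5  : ∀ {n S} (b : Fin n → ℕ) .{{_ : ∀ {j} → NonZero (b j)}} (P Q : Fin n → Formula) →
          (∀ j → Γ ∪ (λ h → ∃ λ i → h ≡ asserted (⟨ b i ∶ P i ⟩ S ^ω ⟨ 0 ∶ Q i ⟩))
                 ⊢[ noR5 ] ⟨ b j ∶ P j ⟩ S ⨾ S ^ω ⟨ 0 ∶ Q j ⟩) →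
          ∀ k → Γ ⊢[ full ] ⟨ b k ∶ P k ⟩ S ^ω ⟨ 0 ∶ Q k ⟩

    R6  : ∀ {μ b e P Q R S} .{{_ : NonZero b}} →
          Γ ⊢[ μ ] ⟨ b ∶ P ⟩ S ⟨ e ∶ R ⟩ →
          Γ ⊢[ μ ] ⟨ b ∶ Q ⟩ S ⟨ e ∶ R ⟩ →
          Γ ⊢[ μ ] ⟨ b ∶ P ∨ Q ⟩ S ⟨ e ∶ R ⟩

    R7  : ∀ {μ b e P Q R S} .{{_ : NonZero b}} →
          Disjoint (varsᶠ R) (vars S) →
          Γ ⊢[ μ ] ⟨ b ∶ P ⟩ S ⟨ e ∶ Q ⟩ →
          Γ ⊢[ μ ] ⟨ b ∶ P ∧ R ⟩ S ⟨ e ∶ Q ∧ R ⟩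

    R8  : ∀ {μ b e P Q S s} .{{_ : NonZero b}} (x : Var s) →
          (s , x) ∉ vars S → (s , x) ∉ varsᶠ Q →
          Γ ⊢[ μ ] ⟨ b ∶ P ⟩ S ⟨ e ∶ Q ⟩ →
          Γ ⊢[ μ ] ⟨ b ∶ exists x P ⟩ S ⟨ e ∶ Q ⟩

    R9  : ∀ {μ b e P Q S s} .{{_ : NonZero b}} (x y : Var s) →
          (s , x) ∉ vars S → (s , y) ∉ vars S →
          Γ ⊢[ μ ] ⟨ b ∶ P ⟩ S ⟨ e ∶ Q ⟩ →
          Γ ⊢[ μ ] ⟨ b ∶ P [ free y / x ] ⟩ S ⟨ e ∶ Q [ free y / x ] ⟩

    R10 : ∀ {μ b e P P′ Q Q′ S} .{{_ : NonZero b}} →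
          Γ (formula (P ⇒ P′)) →
          Γ ⊢[ μ ] ⟨ b ∶ P′ ⟩ S ⟨ e ∶ Q′ ⟩ →
          Γ (formula (Q′ ⇒ Q)) →
          Γ ⊢[ μ ] ⟨ b ∶ P ⟩ S ⟨ e ∶ Q ⟩

  _⊢_ : Pred Hypothesis 0ℓ → Asserted → Set
  Γ ⊢ φ = Γ ⊢[ full ] φ

{-# OPTIONS --safe #-}
module Submission where

-- An assertion is interpreted operationally over total valuations of all
-- variables: execution with k steps of fuel, started at entry b in a valuation
-- satisfying P, ends, if at all, in exit e and a valuation satisfying Q.
-- P and Q thus share their variables outside the state, whereas ⊨ᵃ quantifies
-- them separately in P and in Q; this makes the interpretation stronger than ⊨ᵃ
-- and is what lets, e.g., R6 and R8 preserve it.  For R5 one inducts lexicographically on (k, b): a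
-- derivation for S;S^ω can use a hypothesis about S^ω only after leaving S,
-- which costs a step, or for an entry point beyond S, which lowers b by len S.
-- Finally the n-th projection of the extracted thread, applied to a state,
-- yields ∅ or the result of such a run.

open import Defs
open import Data.Bool using (Bool; true; false)
open import Data.Empty using (⊥-elim)
open import Data.List using (List; []; _∷_; _++_; length)
open import Data.List.Membership.Propositional using (_∈_; _∉_)
open import Data.List.Membership.Propositional.Properties using (∈-++⁺ˡ; ∈-++⁺ʳ)
open import Data.List.NonEmpty as List⁺ using (List⁺; _∷_)
open import Data.List.Properties using (++-identityʳ; length-++)
open import Data.List.Relation.Binary.Subset.Propositional using (_⊆_)
open import Data.List.Relation.Unary.All as All using (All; []; _∷_)
open import Data.List.Relation.Unary.All.Properties using (++⁺)
open import Data.List.Relation.Unary.Any using (here; there)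
open import Data.Maybe as Maybe using (Maybe; just; nothing; _>>=_)
open import Data.Maybe.Properties using (just-injective)
open import Data.Nat using (ℕ; zero; suc; pred; _+_; _≤_; _<_; z≤n; s≤s; NonZero)
open import Data.Nat.Induction using (<-rec)
open import Data.Nat.Properties using (≤-refl; ≤-trans; <-irrefl; <-trans; ≤-<-trans; <⇒≤; m≤n⇒m<n∨m≡n; +-suc; +-monoˡ-≤; m≤m+n; m≤n+m; n≤1+n; m<n⇒m<1+n; m<m+n; +-comm)
open import Data.Product using (Σ; ∃; _×_; _,_; proj₁; proj₂)
import Data.Product as Product
open import Data.Product.Function.NonDependent.Propositional using (_×-⇔_)
open import Data.Sum using (_⊎_; inj₁; inj₂; [_,_]′)
open import Data.Sum.Function.Propositional using (_⊎-⇔_)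
open import Data.Unit using (⊤; tt)
open import Function using (_∘_; _⇔_; mk⇔; Equivalence)
open import Function.Related.TypeIsomorphisms using (→-cong-⇔; ¬-cong-⇔)
open import Function.Properties.Equivalence using () renaming (refl to ⇔-refl)
open import Level using (0ℓ)
open import Relation.Binary.Definitions using (DecidableEquality)
open import Relation.Binary.PropositionalEquality using (_≡_; _≢_; refl; sym; trans; cong; cong₂; subst)
open import Relation.Nullary using (¬_; Dec; yes; no; contradiction)
open import Relation.Unary using (Pred)

module Soundness
  (Focus Method : Set) (_≟ᶠ_ : DecidableEquality Focus) (Sg : Signature)
  (𝔄 : Logic.ServiceAlgebra Focus Method _≟ᶠ_ Sg) where

  open Logic Focus Method _≟ᶠ_ Sg
  open ServiceAlgebra 𝔄
  open Families 𝔄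
  open Equivalence using (to; from)

  -- Substitution and coincidence

  ≡-⇔ : ∀ {A : Set} {a a′ b b′ : A} → a ≡ a′ → b ≡ b′ → (a ≡ b) ⇔ (a′ ≡ b′)
  ≡-⇔ refl refl = ⇔-refl

  Π-⇔ : ∀ {A : Set} {B C : A → Set} → (∀ a → B a ⇔ C a) → (∀ a → B a) ⇔ (∀ a → C a)
  Π-⇔ B⇔C = mk⇔ (λ g a → to (B⇔C a) (g a)) (λ g a → from (B⇔C a) (g a))

  Σ-⇔ : ∀ {A : Set} {B C : A → Set} → (∀ a → B a ⇔ C a) → Σ A B ⇔ Σ A C
  Σ-⇔ B⇔C = mk⇔ (Product.map₂ (to (B⇔C _))) (Product.map₂ (from (B⇔C _)))

  module _ {V W : Sort → Set} {θ : ∀ {s} → V s → Tm W s}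
           {v : ∀ s → V s → Carrier s} {w : ∀ s → W s → Carrier s}
           (v≡wθ : ∀ {s} (x : V s) → v s x ≡ eval w (θ x)) where
    mutual
      eval-bind : ∀ {s} (u : Tm V s) → eval v u ≡ eval w (bind θ u)
      eval-bind (var x)   = v≡wθ x
      eval-bind (op o us) = cong (interpret o) (evals-binds us)

      evals-binds : ∀ {ss} (us : All (Tm V) ss) → evals v us ≡ evals w (binds θ us)
      evals-binds []       = refl
      evals-binds (u ∷ us) = cong₂ _∷_ (eval-bind u) (evals-binds us)

  scoped-lift : ∀ {Γ Δ r} {θ : ∀ {s} → Scope Γ s → Tm (Scope Δ) s} {v w} {γ : All Carrier Γ} {η : All Carrier Δ} →
    (∀ {s} (x : Scope Γ s) → scoped v γ s x ≡ eval (scoped w η) (θ x)) →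
    ∀ (a : Carrier r) {s} (x : Scope (r ∷ Γ) s) →
    scoped v (a ∷ γ) s x ≡ eval (scoped w (a ∷ η)) (lift θ x)
  scoped-lift {θ = θ} {w = w} {η = η} h a = λ where
      (inj₁ x)           → trans (h (inj₁ x)) (weakening (θ (inj₁ x)))
      (inj₂ (here refl)) → refl
      (inj₂ (there i))   → trans (h (inj₂ i)) (weakening (θ (inj₂ i)))
    where
    weakening : ∀ {s} (u : Tm (Scope _) s) → eval (scoped w η) u ≡ eval (scoped w (a ∷ η)) (weaken u)
    weakening = eval-bind λ { (inj₁ _) → refl ; (inj₂ _) → refl }

  Sat-bind : ∀ {Γ Δ} {θ : ∀ {s} → Scope Γ s → Tm (Scope Δ) s} {v w} {γ : All Carrier Γ} {η : All Carrier Δ} →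
    (∀ {s} (x : Scope Γ s) → scoped v γ s x ≡ eval (scoped w η) (θ x)) →
    ∀ P → Sat v γ P ⇔ Sat w η (bindᶠ θ P)
  Sat-bind h ⊤ᶠ        = ⇔-refl
  Sat-bind h ⊥ᶠ        = ⇔-refl
  Sat-bind h (t ≐ u)   = ≡-⇔ (eval-bind h t) (eval-bind h u)
  Sat-bind h (¬ᶠ P)    = ¬-cong-⇔ (Sat-bind h P)
  Sat-bind h (P ∧ Q)   = Sat-bind h P ×-⇔ Sat-bind h Q
  Sat-bind h (P ∨ Q)   = Sat-bind h P ⊎-⇔ Sat-bind h Q
  Sat-bind h (P ⇒ Q)   = →-cong-⇔ (Sat-bind h P) (Sat-bind h Q)
  Sat-bind {v = v} {w} {γ} {η} h (all s P) =
    Π-⇔ λ a → Sat-bind {v = v} {w} {a ∷ γ} {a ∷ η} (scoped-lift {v = v} {w} {γ} {η} h a) P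
  Sat-bind {v = v} {w} {γ} {η} h (ex s P) =
    Σ-⇔ λ a → Sat-bind {v = v} {w} {a ∷ γ} {a ∷ η} (scoped-lift {v = v} {w} {γ} {η} h a) P

  AgreeOn : List Variable → Valuation → Valuation → Set
  AgreeOn F v w = ∀ {s} x → (s , x) ∈ F → v s x ≡ w s x

  agreeˡ : ∀ {F G v w} → AgreeOn (F ++ G) v w → AgreeOn F v w
  agreeˡ h x = h x ∘ ∈-++⁺ˡ

  agreeʳ : ∀ F {G v w} → AgreeOn (F ++ G) v w → AgreeOn G v w
  agreeʳ F h x = h x ∘ ∈-++⁺ʳ F

  module _ {Γ : List Sort} {v w : Valuation} (γ : All Carrier Γ) where
    mutual
      eval-agree : ∀ {s} (u : Tm (Scope Γ) s) →
        AgreeOn (varsᵗ u) v w → eval (scoped v γ) u ≡ eval (scoped w γ) u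
      eval-agree (var (inj₁ x)) h = h x (here refl)
      eval-agree (var (inj₂ i)) h = refl
      eval-agree (op o us)      h = cong (interpret o) (evals-agree us h)

      evals-agree : ∀ {ss} (us : All (Tm (Scope Γ)) ss) →
        AgreeOn (varsᵗˢ us) v w → evals (scoped v γ) us ≡ evals (scoped w γ) us
      evals-agree []       h = refl
      evals-agree (u ∷ us) h = cong₂ _∷_ (eval-agree u (agreeˡ h)) (evals-agree us (agreeʳ (varsᵗ u) h))

  Sat-agree : ∀ {Γ v w} {γ : All Carrier Γ} P → AgreeOn (varsᶠ P) v w → Sat v γ P ⇔ Sat w γ P
  Sat-agree ⊤ᶠ        h = ⇔-refl
  Sat-agree ⊥ᶠ        h = ⇔-refl
  Sat-agree {γ = γ} (t ≐ u) h = ≡-⇔ (eval-agree γ t (agreeˡ h)) (eval-agree γ u (agreeʳ (varsᵗ t) h))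
  Sat-agree (¬ᶠ P)    h = ¬-cong-⇔ (Sat-agree P h)
  Sat-agree (P ∧ Q)   h = Sat-agree P (agreeˡ h) ×-⇔ Sat-agree Q (agreeʳ (varsᶠ P) h)
  Sat-agree (P ∨ Q)   h = Sat-agree P (agreeˡ h) ⊎-⇔ Sat-agree Q (agreeʳ (varsᶠ P) h)
  Sat-agree (P ⇒ Q)   h = →-cong-⇔ (Sat-agree P (agreeˡ h)) (Sat-agree Q (agreeʳ (varsᶠ P) h))
  Sat-agree (all s P) h = Π-⇔ λ a → Sat-agree P h
  Sat-agree (ex s P)  h = Σ-⇔ λ a → Sat-agree P h

  update : ∀ {r} → Var r → Carrier r → Valuation → Valuation
  update {r} x a v s y with (r , x) ≟ (s , y)
  ... | yes refl = a
  ... | no  _    = v s y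

  update-same : ∀ {s} (x : Var s) {a v} → update x a v s x ≡ a
  update-same {s} x with (s , x) ≟ (s , x)
  ... | yes refl = refl
  ... | no  x≢x  = contradiction refl x≢x

  update-other : ∀ {r s} (x : Var r) {a v} (y : Var s) → (r , x) ≢ (s , y) → update x a v s y ≡ v s y
  update-other {r} {s} x y x≢y with (r , x) ≟ (s , y)
  ... | yes refl = contradiction refl x≢y
  ... | no  _    = refl

  update-cong : ∀ {r s} (x : Var r) {a b v w} (y : Var s) → a ≡ b →
    ((r , x) ≢ (s , y) → v s y ≡ w s y) → update x a v s y ≡ update x b w s y
  update-cong {r} {s} x y a≡b h with (r , x) ≟ (s , y)
  ... | yes refl = a≡b
  ... | no  x≢y  = h x≢y

  scoped-replace : ∀ {Γ r} v (γ : All Carrier Γ) (u : Tm (Scope Γ) r) (x : Var r) {s} (y : Scope Γ s) →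
    scoped (update x (eval (scoped v γ) u) v) γ s y ≡ eval (scoped v γ) (replace u x y)
  scoped-replace {r = r} v γ u x {s} (inj₁ y) with (r , x) ≟ (s , y)
  ... | yes refl = refl
  ... | no  _    = refl
  scoped-replace v γ u x (inj₂ i) = refl

  Sat-[/] : ∀ {r v} P (u : Tm (Scope []) r) (x : Var r) →
    Sat (update x (eval (scoped v []) u) v) [] P ⇔ Sat v [] (P [ u / x ])
  Sat-[/] {v = v} P u x = Sat-bind {θ = replace u x} {w = v} {γ = []} {η = []} (scoped-replace v [] u x) P

  -- `exists x P` first weakens `P` and then puts the bound variable for `x`; the two uses of
  -- `Sat-bind` undo these operations in reverse order.
  Sat-exists : ∀ {r v} P (x : Var r) → Sat v [] (exists x P) → ∃ λ a → Sat (update x a v) [] P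
  Sat-exists {r} {v} P x (a , p) =
    a , from (Sat-bind {v = update x a v} {w = update x a v} {γ = []} {η = a ∷ []} (λ { (inj₁ _) → refl }) P)
          (from (Sat-bind {θ = replace u x} {w = v} {γ = a ∷ []} {η = a ∷ []} (scoped-replace v (a ∷ []) u x) _) p)
    where
    u : Tm (Scope (r ∷ [])) r
    u = var (inj₂ (here refl))

  -- `P [ t ]` leaves free the foci without a service in `t` and all variables of other sorts; the
  -- default `v` for these turns a state into a total valuation.
  overlay : SF → Valuation → Valuation
  overlay t v serv      f = Maybe.maybe′ value (v serv f) (service f t)
  overlay t v repl      x = v repl x
  overlay t v (extra i) x = v (extra i) x

  value-open-closed : ∀ {s} {v : ∀ s → Scope [] s → Carrier s} (c : Closed s) → value c ≡ eval v (open-closed c)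
  value-open-closed = eval-bind λ ()

  Sat-instantiate : ∀ {v} P t → Sat (overlay t v) [] P ⇔ Sat v [] (P [ t ])
  Sat-instantiate {v} P t = Sat-bind {θ = instantiate t} {v = overlay t v} {w = v} {γ = []} {η = []} agree P
    where
    agree : ∀ {s} (x : Scope [] s) → scoped (overlay t v) [] s x ≡ eval (scoped v []) (instantiate t x)
    agree {serv}    (inj₁ f) with service f t
    ... | just c  = value-open-closed c
    ... | nothing = refl
    agree {repl}    (inj₁ x) = refl
    agree {extra i} (inj₁ x) = refl

  -- Positions in an instruction sequence

  -- `outside l` is the position reached by leaving through exit l + 1.
  data Pos : Set where
    inside  : Seq → Pos
    outside : ℕ → Pos

  -- 0-based, whereas jumps and entry points are 1-based.
  advance : ℕ → Maybe Seq → Pos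
  advance l       nothing  = outside l
  advance zero    (just X) = inside X
  advance (suc l) (just X) = advance l (rest X)

  toMaybe : Pos → Maybe Seq
  toMaybe (inside X)  = just X
  toMaybe (outside _) = nothing

  jump-advance : ∀ l mX → jump (suc l) mX ≡ toMaybe (advance l mX)
  jump-advance l       nothing  = refl
  jump-advance zero    (just X) = refl
  jump-advance (suc l) (just X) = jump-advance l (rest X)

  glue : Maybe Seq → Seq → Seq
  glue nothing  Y = Y
  glue (just X) Y = X ++ˢ Y

  andThen : Pos → Seq → Pos
  andThen (inside X)  Y = inside (X ++ˢ Y)
  andThen (outside l) Y = advance l (just Y)

  first-++ˢ : ∀ X Y → first (X ++ˢ Y) ≡ first X
  first-++ˢ (fin (x ∷ xs))         (fin (y ∷ ys)) = refl
  first-++ˢ (fin (x ∷ xs))         (lasso us vs)  = refl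
  first-++ˢ (lasso [] (v ∷ vs))    Y              = refl
  first-++ˢ (lasso (u ∷ us) vs)    Y              = refl

  rest-++ˢ : ∀ X Y → rest (X ++ˢ Y) ≡ just (glue (rest X) Y)
  rest-++ˢ (fin (x ∷ []))      (fin (y ∷ ys)) = refl
  rest-++ˢ (fin (x ∷ [])) (lasso us vs)       = refl
  rest-++ˢ (fin (x ∷ z ∷ zs))  (fin (y ∷ ys)) = refl
  rest-++ˢ (fin (x ∷ z ∷ zs)) (lasso us vs)   = refl
  rest-++ˢ (lasso [] (v ∷ vs)) Y              = refl
  rest-++ˢ (lasso (u ∷ us) vs) Y              = refl

  advance-glue : ∀ l mX Y → advance l (just (glue mX Y)) ≡ andThen (advance l mX) Y
  advance-glue l       nothing  Y = refl
  advance-glue zero    (just X) Y = refl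
  advance-glue (suc l) (just X) Y =
    trans (cong (advance l) (rest-++ˢ X Y)) (advance-glue l (rest X) Y)

  advance-rest-++ˢ : ∀ l X Y → advance l (rest (X ++ˢ Y)) ≡ andThen (advance l (rest X)) Y
  advance-rest-++ˢ l X Y = advance-glue (suc l) (just X) Y

  lenˢ : Seq → Length
  lenˢ (fin xs)    = finite (List⁺.length xs)
  lenˢ (lasso _ _) = ω

  len≡lenˢ : ∀ S → len S ≡ lenˢ ⟦ S ⟧
  len≡lenˢ S with ⟦ S ⟧
  ... | fin xs    = refl
  ... | lasso _ _ = refl

  advance-inside : ∀ l X → suc l ≤ᴸ lenˢ X → ∃ λ Y → advance l (just X) ≡ inside Y
  advance-inside zero    X                   _         = X , refl
  advance-inside (suc l) (fin (x ∷ y ∷ ys))  (s≤s l<n) = advance-inside l (fin (y ∷ ys)) l<n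
  advance-inside (suc l) (lasso [] (v ∷ vs)) _         = advance-inside l (lasso vs (v ∷ vs)) tt
  advance-inside (suc l) (lasso (u ∷ us) vs) _         = advance-inside l (lasso us vs) tt
  advance-inside (suc l) (fin (x ∷ []))      (s≤s ())

  advance-past : ∀ l X {n} → lenˢ X ≡ finite n → advance (l + n) (just X) ≡ outside l
  advance-past l (fin (x ∷ xs)) refl rewrite +-suc l (length xs) = past xs
    where
    past : ∀ {x} xs → advance (l + length xs) (rest (fin (x ∷ xs))) ≡ outside l
    past []       = cong outside (+-comm l 0)
    past (y ∷ ys) rewrite +-suc l (length ys) = past ys

  length-⁺++⁺ : ∀ {A : Set} (xs ys : List⁺ A) → List⁺.length (xs List⁺.⁺++⁺ ys) ≡ List⁺.length xs + List⁺.length ys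
  length-⁺++⁺ (x ∷ xs) (y ∷ ys) = cong suc (length-++ xs)

  ≤ᴸ-++ˢˡ : ∀ {b} X Y → b ≤ᴸ lenˢ X → b ≤ᴸ lenˢ (X ++ˢ Y)
  ≤ᴸ-++ˢˡ (fin xs)     (fin ys)    b≤ rewrite length-⁺++⁺ xs ys = ≤-trans b≤ (m≤m+n _ _)
  ≤ᴸ-++ˢˡ (fin xs)     (lasso _ _) b≤ = tt
  ≤ᴸ-++ˢˡ (lasso _ _)  Y           b≤ = tt

  ≤ᴸ-++ˢʳ : ∀ {b n} X Y → lenˢ X ≡ finite n → b ≤ᴸ lenˢ Y → b + n ≤ᴸ lenˢ (X ++ˢ Y)
  ≤ᴸ-++ˢʳ {b} (fin xs) (fin ys) refl b≤
    rewrite length-⁺++⁺ xs ys | +-comm (List⁺.length xs) (List⁺.length ys) = +-monoˡ-≤ _ b≤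
  ≤ᴸ-++ˢʳ (fin xs) (lasso _ _) refl b≤ = tt

  -- For finite `S` the two sequences have different representations: unfolding yields a copy of `S`
  -- as prefix, where `S ^ω` has an empty one. They become identical after one `rest`, so head and
  -- `rest` are compared instead.
  first-unfold : ∀ S → first ⟦ S ⨾ S ^ω ⟧ ≡ first ⟦ S ^ω ⟧
  first-unfold S with ⟦ S ⟧
  ... | fin (x ∷ xs) = refl
  ... | lasso us vs  = refl

  rest-unfold : ∀ S → rest ⟦ S ⨾ S ^ω ⟧ ≡ rest ⟦ S ^ω ⟧
  rest-unfold S with ⟦ S ⟧
  ... | fin (x ∷ xs) = cong (λ us → just (lasso us (x ∷ xs))) (++-identityʳ xs)
  ... | lasso us vs  = refl

  -- Execution

  -- Execution and, through `respond`, the apply operator both branch by `choose` on `reply`, so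
  -- that a single case distinction reduces both.
  choose : ∀ {A : Set} → Maybe Bool → A → A → A → A
  choose (just true)  x y z = x
  choose (just false) x y z = y
  choose nothing      x y z = z

  reply : Method → Carrier serv → Maybe Bool
  reply m z with ρᴬ m z ≟ʳ tᴬ | ρᴬ m z ≟ʳ fᴬ
  ... | yes _ | _     = just true
  ... | no _  | yes _ = just false
  ... | no _  | no _  = nothing

  -- `test a i j` performs a and then skips i instructions on a positive and
  -- j instructions on a negative reply.
  data Kind : Set where
    test : Basic → ℕ → ℕ → Kind
    jmp  : ℕ → Kind
    stop : Kind

  kind : Instr → Kind
  kind (plain a) = test a 0 0
  kind (pos a)   = test a 0 1
  kind (neg a)   = test a 1 0
  kind (# l)     = jmp l
  kind !         = stop

  data Action : Set where
    halt stuck : Action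
    go         : ℕ → Valuation → Action

  derived : Focus → Method → Valuation → Valuation
  derived f m v = update {serv} f (∂ᴬ m (v serv f)) v

  exec : Kind → Valuation → Action
  exec (test (f ∙ m) i j) v =
    choose (reply m (v serv f)) (go i (derived f m v)) (go j (derived f m v)) stuck
  exec (jmp zero)    v = stuck
  -- `go` counts the instructions skipped after the current one, which is one less than the jump
  -- distance.
  exec (jmp (suc l)) v = go l v
  exec stop          v = halt

  Post : Set₁
  Post = ℕ → Valuation → Set

  -- Execution with k steps of fuel ends, if at all, in exit e and valuation v
  -- with Φ e v; exit 0 is termination.  Every focus is taken to be present.
  mutual
    Safe : ℕ → Pos → Valuation → Post → Set
    Safe k       (outside l) v Φ = Φ (suc l) v
    Safe zero    (inside X)  v Φ = ⊤
    Safe (suc k) (inside X)  v Φ = SafeAfter k (rest X) v Φ (exec (kind (first X)) v)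

    SafeAfter : ℕ → Maybe Seq → Valuation → Post → Action → Set
    SafeAfter k mX v Φ halt     = Φ 0 v
    SafeAfter k mX v Φ stuck    = ⊤
    SafeAfter k mX v Φ (go l w) = Safe k (advance l mX) w Φ

  -- The run starts inside `X`, so at least one instruction is executed before `Y` is reached; hence
  -- the strict `j < k`.
  Safe-seq : ∀ {k X Y v} {Φ Ψ : Post} →
    (∀ {w} → Φ 0 w → Ψ 0 w) →
    (∀ {j l w} → j < k → Φ (suc l) w → Safe j (advance l (just Y)) w Ψ) →
    Safe k (inside X) v Φ → Safe k (inside (X ++ˢ Y)) v Ψ
  Safe-seq {zero} h₀ h₁ s = tt
  Safe-seq {suc k} {X} {Y} {v} h₀ h₁ s
    rewrite first-++ˢ X Y with exec (kind (first X)) v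
  ... | halt   = h₀ s
  ... | stuck  = tt
  ... | go l w rewrite advance-rest-++ˢ l X Y with advance l (rest X)
  ...   | inside X′  = Safe-seq h₀ (λ j<k → h₁ (m<n⇒m<1+n j<k)) s
  ...   | outside l′ = h₁ ≤-refl s

  -- Only at entry 0 do the representations of the two sequences differ; there one step of execution
  -- is exposed, which depends on the head and the `rest` alone.
  Safe-unfold : ∀ {k v Φ} S l →
    Safe k (advance l (just ⟦ S ⨾ S ^ω ⟧)) v Φ → Safe k (advance l (just ⟦ S ^ω ⟧)) v Φ
  Safe-unfold {zero}          S zero    s = tt
  Safe-unfold {suc k} {v} {Φ} S zero    s =
    subst (λ u → SafeAfter k (rest ⟦ S ^ω ⟧) v Φ (exec (kind u) v)) (first-unfold S)
      (subst (λ mX → SafeAfter k mX v Φ (exec (kind (first ⟦ S ⨾ S ^ω ⟧)) v)) (rest-unfold S) s)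
  Safe-unfold {k} {v} {Φ}     S (suc l) s = subst (λ mX → Safe k (advance l mX) v Φ) (rest-unfold S) s

  -- Transfer of executions between related valuations

  Covers : List Variable → Seq → Set
  Covers F (fin xs)      = All (λ u → varsⁱ u ⊆ F) (List⁺.toList xs)
  Covers F (lasso us vs) = All (λ u → varsⁱ u ⊆ F) us × All (λ u → varsⁱ u ⊆ F) (List⁺.toList vs)

  CoversPos : List Variable → Pos → Set
  CoversPos F (inside X)  = Covers F X
  CoversPos F (outside l) = ⊤

  covers-first : ∀ {F} X → Covers F X → varsⁱ (first X) ⊆ F
  covers-first (fin (x ∷ xs))      (c ∷ _)     = c
  covers-first (lasso [] (v ∷ vs)) (_ , c ∷ _) = c
  covers-first (lasso (u ∷ us) vs) (c ∷ _ , _) = c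

  covers-advance : ∀ {F} l X → Covers F X → CoversPos F (advance l (just X))
  covers-advance zero    X                   c             = c
  covers-advance (suc l) (fin (x ∷ []))      c             = tt
  covers-advance (suc l) (fin (x ∷ y ∷ ys))  (_ ∷ c)       = covers-advance l (fin (y ∷ ys)) c
  covers-advance (suc l) (lasso [] (v ∷ vs)) (_ , c ∷ cs)  = covers-advance l (lasso vs (v ∷ vs)) (cs , c ∷ cs)
  covers-advance (suc l) (lasso (u ∷ us) vs) (_ ∷ cs , c)  = covers-advance l (lasso us vs) (cs , c)

  covers-++ˢ : ∀ {F} X Y → Covers F X → Covers F Y → Covers F (X ++ˢ Y)
  covers-++ˢ (fin (x ∷ xs)) (fin (y ∷ ys)) c       d       = ++⁺ c d
  covers-++ˢ (fin (x ∷ xs)) (lasso us vs)  c       (d , e) = ++⁺ c d , e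
  covers-++ˢ (lasso us vs)  Y              c       d       = c

  covers-repeat : ∀ {F} X → Covers F X → Covers F (repeat X)
  covers-repeat (fin xs)      c = [] , c
  covers-repeat (lasso us vs) c = c

  covers-⟦⟧ : ∀ {F} S → vars S ⊆ F → Covers F ⟦ S ⟧
  covers-⟦⟧ ⟨ u ⟩   h = h ∷ []
  covers-⟦⟧ (S ⨾ T) h =
    covers-++ˢ ⟦ S ⟧ ⟦ T ⟧ (covers-⟦⟧ S (h ∘ ∈-++⁺ˡ)) (covers-⟦⟧ T (h ∘ ∈-++⁺ʳ (vars S)))
  covers-⟦⟧ (S ^ω)  h = covers-repeat ⟦ S ⟧ (covers-⟦⟧ S h)

  kind-focus : ∀ {f m i j} u → kind u ≡ test (f ∙ m) i j → (serv , f) ∈ varsⁱ u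
  kind-focus (plain (f ∙ m)) refl = here refl
  kind-focus (pos (f ∙ m))   refl = here refl
  kind-focus (neg (f ∙ m))   refl = here refl

  -- What two runs of a sequence with foci in `F` need in order to take the same branches: `same`
  -- gives equal replies, and `stable` preserves the relation under the updates made by actions.
  record Simulation (F : List Variable) (R : Valuation → Valuation → Set) : Set where
    field
      same   : ∀ {v w f} → (serv , f) ∈ F → R v w → v serv f ≡ w serv f
      stable : ∀ {v w f} a → (serv , f) ∈ F → R v w → R (update {serv} f a v) (update {serv} f a w)

  module _ {F : List Variable} {R : Valuation → Valuation → Set} (sim : Simulation F R) where
    open Simulation sim

    Image : Post → Post
    Image Φ e w = ∃ λ v → R v w × Φ e v

    mutual
      Safe-simulate : ∀ {k v w Φ} p → CoversPos F p → R v w → Safe k p v Φ → Safe k p w (Image Φ)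
      Safe-simulate         (outside l) c r s = _ , r , s
      Safe-simulate {zero}  (inside X)  c r s = tt
      Safe-simulate {suc k} (inside X)  c r s = SafeAfter-simulate X c r (kind (first X)) refl s

      -- The kind is abstracted to `κ` together with an equation: one can split on `κ` and still
      -- recover from the equation that the focus of a test lies in `F`.
      SafeAfter-simulate : ∀ {k v w Φ} X → Covers F X → R v w → ∀ κ → kind (first X) ≡ κ →
        SafeAfter k (rest X) v Φ (exec κ v) → SafeAfter k (rest X) w (Image Φ) (exec κ w)
      SafeAfter-simulate {v = v} {w} X c r (test (f ∙ m) i j) eq s
        with f∈F ← covers-first X c (kind-focus (first X) eq)
        rewrite sym (same f∈F r)
        with reply m (v serv f)
      ... | just true  = Safe-simulate (advance i (rest X)) (covers-advance (suc i) X c) (stable _ f∈F r) s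
      ... | just false = Safe-simulate (advance j (rest X)) (covers-advance (suc j) X c) (stable _ f∈F r) s
      ... | nothing    = tt
      SafeAfter-simulate X c r (jmp zero)    eq s = tt
      SafeAfter-simulate X c r (jmp (suc l)) eq s = Safe-simulate (advance l (rest X)) (covers-advance (suc l) X c) r s
      SafeAfter-simulate X c r stop          eq s = _ , r , s

  mutual
    Safe-map : ∀ {k v} {Φ Ψ : Post} p → (∀ {e w} → Φ e w → Ψ e w) → Safe k p v Φ → Safe k p v Ψ
    Safe-map         (outside l) h s = h s
    Safe-map {zero}  (inside X)  h s = tt
    Safe-map {suc k} (inside X)  h s = SafeAfter-map (rest X) (exec (kind (first X)) _) h s

    SafeAfter-map : ∀ {k v} {Φ Ψ : Post} mX α → (∀ {e w} → Φ e w → Ψ e w) →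
      SafeAfter k mX v Φ α → SafeAfter k mX v Ψ α
    SafeAfter-map mX halt     h s = h s
    SafeAfter-map mX stuck    h s = tt
    SafeAfter-map mX (go l w) h s = Safe-map (advance l mX) h s

  -- The length bound places the entry point within `X`, so `Safe-seq` applies from there.
  Safe-enter : ∀ {k v} {Φ Ψ : Post} l X Y → suc l ≤ᴸ lenˢ X →
    (∀ {w} → Φ 0 w → Ψ 0 w) →
    (∀ {j l′ w} → j < k → Φ (suc l′) w → Safe j (advance l′ (just Y)) w Ψ) →
    Safe k (advance l (just X)) v Φ → Safe k (advance l (just (X ++ˢ Y))) v Ψ
  Safe-enter l X Y l<n h₀ h₁ s
    rewrite advance-glue l (just X) Y with advance l (just X) | advance-inside l X l<n
  ... | _ | X′ , refl = Safe-seq h₀ h₁ s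

  -- Soundness of the rules

  Ends : ℕ → Formula → Post
  Ends e Q e′ v = e′ ≡ e × Sat v [] Q

  Valid : ℕ → Asserted → Set
  Valid k (⟨ b ∶ P ⟩ S ⟨ e ∶ Q ⟩) =
    b ≤ᴸ lenˢ ⟦ S ⟧ ×
    (∀ v → Sat v [] P → Safe k (advance (pred b) (just ⟦ S ⟧)) v (Ends e Q))

  Safe-test : ∀ {f m i j} k v Φ u → kind u ≡ test (f ∙ m) i j →
    (ρᴬ m (v serv f) ≡ tᴬ → Φ (suc i) (derived f m v)) →
    (ρᴬ m (v serv f) ≡ fᴬ → Φ (suc j) (derived f m v)) →
    Safe k (inside ⟦ ⟨ u ⟩ ⟧) v Φ
  Safe-test zero v Φ u eq ht hf = tt
  Safe-test {f} {m} (suc k) v Φ u eq ht hf rewrite eq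
    with ρᴬ m (v serv f) ≟ʳ tᴬ | ρᴬ m (v serv f) ≟ʳ fᴬ
  ... | yes ρ≡t | _       = ht ρ≡t
  ... | no _    | yes ρ≡f = hf ρ≡f
  ... | no _    | no _    = tt

  Sat-after : ∀ {v f m} P → Sat v [] (after m f P) → Sat (derived f m v) [] P
  Sat-after {f = f} {m} P = from (Sat-[/] P (op (∂ m) (free {serv} f ∷ [])) f)

  valid-A1 : ∀ {f m P} k → Valid k (⟨ 1 ∶ ¬ᶠ ρ≐ m f 𝖽 ∧ after m f P ⟩ ⟨ plain (f ∙ m) ⟩ ⟨ 1 ∶ P ⟩)
  valid-A1 {f} {m} {P} k = ≤-refl , λ v (_ , p) →
    Safe-test k v (Ends 1 P) (plain (f ∙ m)) refl (λ _ → refl , Sat-after {v} P p) (λ _ → refl , Sat-after {v} P p)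

  valid-𝗍 : ∀ {f m i j P} k u → kind u ≡ test (f ∙ m) i j →
    Valid k (⟨ 1 ∶ ρ≐ m f 𝗍 ∧ after m f P ⟩ ⟨ u ⟩ ⟨ suc i ∶ P ⟩)
  valid-𝗍 {i = i} {P = P} k u eq = ≤-refl , λ v (ρ≡t , p) →
    Safe-test k v (Ends (suc i) P) u eq (λ _ → refl , Sat-after {v} P p) (λ ρ≡f → contradiction (trans (sym ρ≡t) ρ≡f) t≢f)

  valid-𝖿 : ∀ {f m i j P} k u → kind u ≡ test (f ∙ m) i j →
    Valid k (⟨ 1 ∶ ρ≐ m f 𝖿 ∧ after m f P ⟩ ⟨ u ⟩ ⟨ suc j ∶ P ⟩)
  valid-𝖿 {j = j} {P = P} k u eq = ≤-refl , λ v (ρ≡f , p) →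
    Safe-test k v (Ends (suc j) P) u eq (λ ρ≡t → contradiction (trans (sym ρ≡t) ρ≡f) t≢f) (λ _ → refl , Sat-after {v} P p)

  valid-𝖽 : ∀ {f m i j} k u → kind u ≡ test (f ∙ m) i j →
    Valid k (⟨ 1 ∶ ρ≐ m f 𝖽 ⟩ ⟨ u ⟩ ⟨ 0 ∶ ⊥ᶠ ⟩)
  valid-𝖽 k u eq = ≤-refl , λ v ρ≡d →
    Safe-test k v (Ends 0 ⊥ᶠ) u eq
      (λ ρ≡t → contradiction (trans (sym ρ≡t) ρ≡d) t≢d)
      (λ ρ≡f → contradiction (trans (sym ρ≡f) ρ≡d) f≢d)

  valid-A9 : ∀ {i P} k → Valid k (⟨ 1 ∶ P ⟩ ⟨ # (suc i) ⟩ ⟨ suc i ∶ P ⟩)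
  valid-A9 zero    = ≤-refl , λ v p → tt
  valid-A9 (suc k) = ≤-refl , λ v p → refl , p

  valid-A10 : ∀ k → Valid k (⟨ 1 ∶ ⊤ᶠ ⟩ ⟨ # 0 ⟩ ⟨ 0 ∶ ⊥ᶠ ⟩)
  valid-A10 zero    = ≤-refl , λ v p → tt
  valid-A10 (suc k) = ≤-refl , λ v p → tt

  valid-A11 : ∀ {P} k → Valid k (⟨ 1 ∶ P ⟩ ⟨ ! ⟩ ⟨ 0 ∶ P ⟩)
  valid-A11 zero    = ≤-refl , λ v p → tt
  valid-A11 (suc k) = ≤-refl , λ v p → refl , p

  -- S₁ is left after at least one step, so S₂ is needed with less fuel only.
  valid-R1 : ∀ {k b i e P Q R} S₁ S₂ .{{_ : NonZero b}} .{{_ : NonZero i}} →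
    Valid k (⟨ b ∶ P ⟩ S₁ ⟨ i ∶ Q ⟩) → (∀ {j} → j < k → Valid j (⟨ i ∶ Q ⟩ S₂ ⟨ e ∶ R ⟩)) →
    Valid k (⟨ b ∶ P ⟩ S₁ ⨾ S₂ ⟨ e ∶ R ⟩)
  valid-R1 {b = suc b} {suc i} S₁ S₂ (b≤ , s₁) s₂ = ≤ᴸ-++ˢˡ ⟦ S₁ ⟧ ⟦ S₂ ⟧ b≤ , λ v p →
    -- Termination inside `S₁` would be exit 0, whereas the exit `i` is positive.
    Safe-enter b ⟦ S₁ ⟧ ⟦ S₂ ⟧ b≤ (λ ()) (λ { j<k (refl , q) → proj₂ (s₂ j<k) _ q }) (s₁ v p)

  -- Exit `e + n` of `S₁` jumps over all `n` instructions of `S₂`, so that it is exit `e` of the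
  -- whole.
  valid-R2 : ∀ {k b e n P Q} S₁ S₂ .{{_ : NonZero b}} .{{_ : NonZero e}} → len S₂ ≡ finite n →
    Valid k (⟨ b ∶ P ⟩ S₁ ⟨ e + n ∶ Q ⟩) → Valid k (⟨ b ∶ P ⟩ S₁ ⨾ S₂ ⟨ e ∶ Q ⟩)
  valid-R2 {b = suc b} {suc e} {n} {Q = Q} S₁ S₂ len≡n (b≤ , s₁) = ≤ᴸ-++ˢˡ ⟦ S₁ ⟧ ⟦ S₂ ⟧ b≤ , λ v p →
    Safe-enter b ⟦ S₁ ⟧ ⟦ S₂ ⟧ b≤ (λ ())
      (λ { {j} {w = w} _ (refl , q) →
        subst (λ r → Safe j r w (Ends (suc e) Q))
          (sym (advance-past e ⟦ S₂ ⟧ (trans (sym (len≡lenˢ S₂)) len≡n))) (refl , q) })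
      (s₁ v p)

  valid-R3 : ∀ {k b P Q} S₁ S₂ .{{_ : NonZero b}} →
    Valid k (⟨ b ∶ P ⟩ S₁ ⟨ 0 ∶ Q ⟩) → Valid k (⟨ b ∶ P ⟩ S₁ ⨾ S₂ ⟨ 0 ∶ Q ⟩)
  valid-R3 {b = suc b} S₁ S₂ (b≤ , s₁) = ≤ᴸ-++ˢˡ ⟦ S₁ ⟧ ⟦ S₂ ⟧ b≤ , λ v p →
    Safe-enter b ⟦ S₁ ⟧ ⟦ S₂ ⟧ b≤ (λ q → q) (λ { _ (() , _) }) (s₁ v p)

  valid-R4 : ∀ {k b e n P Q} S₁ S₂ .{{_ : NonZero b}} .{{_ : NonZero (b + n)}} → len S₁ ≡ finite n →
    Valid k (⟨ b ∶ P ⟩ S₂ ⟨ e ∶ Q ⟩) → Valid k (⟨ b + n ∶ P ⟩ S₁ ⨾ S₂ ⟨ e ∶ Q ⟩)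
  valid-R4 {k} {suc b} {e} {n} {Q = Q} S₁ S₂ len≡n (b≤ , s₂) = ≤ᴸ-++ˢʳ ⟦ S₁ ⟧ ⟦ S₂ ⟧ len≡ b≤ , λ v p →
    subst (λ r → Safe k r v (Ends e Q)) (sym skip) (s₂ v p)
    where
    len≡ : lenˢ ⟦ S₁ ⟧ ≡ finite n
    len≡ = trans (sym (len≡lenˢ S₁)) len≡n
    skip : advance (b + n) (just (⟦ S₁ ⟧ ++ˢ ⟦ S₂ ⟧)) ≡ advance b (just ⟦ S₂ ⟧)
    skip = trans (advance-glue (b + n) (just ⟦ S₁ ⟧) ⟦ S₂ ⟧)
                 (cong (λ r → andThen r ⟦ S₂ ⟧) (advance-past b ⟦ S₁ ⟧ len≡))

  valid-fold : ∀ {k b P Q} S .{{_ : NonZero b}} →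
    Valid k (⟨ b ∶ P ⟩ S ⨾ S ^ω ⟨ 0 ∶ Q ⟩) → Valid k (⟨ b ∶ P ⟩ S ^ω ⟨ 0 ∶ Q ⟩)
  valid-fold {b = b} S (_ , s) = repeat-infinite ⟦ S ⟧ , λ v p → Safe-unfold S (pred b) (s v p)
    where
    repeat-infinite : ∀ X → b ≤ᴸ lenˢ (repeat X)
    repeat-infinite (fin xs)      = tt
    repeat-infinite (lasso us vs) = tt

  valid-R6 : ∀ {k b e P Q R} S .{{_ : NonZero b}} →
    Valid k (⟨ b ∶ P ⟩ S ⟨ e ∶ R ⟩) → Valid k (⟨ b ∶ Q ⟩ S ⟨ e ∶ R ⟩) → Valid k (⟨ b ∶ P ∨ Q ⟩ S ⟨ e ∶ R ⟩)
  valid-R6 S (b≤ , s) (_ , s′) = b≤ , λ v → [ s v , s′ v ]′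

  Safe-simulate-⟦⟧ : ∀ {R k v w} {Φ Ψ : Post} l S → Simulation (vars S) R → R v w →
    (∀ {e v w} → R v w → Φ e v → Ψ e w) →
    Safe k (advance l (just ⟦ S ⟧)) v Φ → Safe k (advance l (just ⟦ S ⟧)) w Ψ
  Safe-simulate-⟦⟧ l S sim r h s =
    Safe-map (advance l (just ⟦ S ⟧)) (λ (_ , r , φ) → h r φ)
      (Safe-simulate sim (advance l (just ⟦ S ⟧)) (covers-advance l ⟦ S ⟧ (covers-⟦⟧ S (λ x∈ → x∈))) r s)

  -- Each run is simulated by itself, with the truth of `R` as an invariant: updates touch only foci
  -- of `S`, and these do not occur in `R`.
  valid-R7 : ∀ {k b e P Q} R S .{{_ : NonZero b}} → (∀ {x} → ¬ (x ∈ varsᶠ R × x ∈ vars S)) →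
    Valid k (⟨ b ∶ P ⟩ S ⟨ e ∶ Q ⟩) → Valid k (⟨ b ∶ P ∧ R ⟩ S ⟨ e ∶ Q ∧ R ⟩)
  valid-R7 {b = b} {Q = Q} R S disjoint (b≤ , s) = b≤ , λ v (p , r) →
    Safe-simulate-⟦⟧ (pred b) S sim ((λ _ → refl) , r)
      (λ { (v≗w , r) (e≡ , q) → e≡ , to (Sat-agree Q (λ x _ → v≗w x)) q , r })
      (s v p)
    where
    sim : Simulation (vars S) (λ v w → (∀ {s} (x : Var s) → v s x ≡ w s x) × Sat w [] R)
    sim = record
      { same   = λ { {f = f} _ (v≗w , _) → v≗w {serv} f }
      ; stable = λ { {f = f} a f∈S (v≗w , r) →
          (λ x → update-cong {serv} f x refl (λ _ → v≗w x)) ,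
          from (Sat-agree R λ x x∈R → update-other {serv} f x λ { refl → disjoint (x∈R , f∈S) }) r }
      }

  SameExcept : ∀ {r} → Var r → Valuation → Valuation → Set
  SameExcept {r} x v w = ∀ {s} (y : Var s) → (r , x) ≢ (s , y) → v s y ≡ w s y

  sameExcept-simulation : ∀ {r F} (x : Var r) → (r , x) ∉ F → Simulation F (SameExcept x)
  sameExcept-simulation x x∉F = record
    { same   = λ { {f = f} f∈F v≈w → v≈w {serv} f λ { refl → x∉F f∈F } }
    ; stable = λ { {f = f} a _ v≈w y x≢y → update-cong {serv} f y refl (λ _ → v≈w y x≢y) }
    }

  -- The run from `v` is compared with that from `v` with the witness at `x`; neither `S` nor `Q`
  -- sees the difference.
  valid-R8 : ∀ {k b e P Q} S {r} .{{_ : NonZero b}} (x : Var r) → (r , x) ∉ vars S → (r , x) ∉ varsᶠ Q →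
    Valid k (⟨ b ∶ P ⟩ S ⟨ e ∶ Q ⟩) → Valid k (⟨ b ∶ exists x P ⟩ S ⟨ e ∶ Q ⟩)
  valid-R8 {b = b} {P = P} {Q} S x x∉S x∉Q (b≤ , s) = b≤ , λ v ∃p →
    let a , p = Sat-exists P x ∃p in
    Safe-simulate-⟦⟧ (pred b) S (sameExcept-simulation x x∉S) (λ y x≢y → update-other x y x≢y)
      (λ { v≈w (e≡ , q) → e≡ , to (Sat-agree Q λ y y∈Q → v≈w y λ { refl → x∉Q y∈Q }) q })
      (s (update x a v) p)

  -- The given assertion is used in the valuation that has the value of `y` at `x`. The simulation
  -- keeps that value equal to the one of `y` in the actual run, as `S` changes neither variable.
  valid-R9 : ∀ {k b e P Q} S {r} .{{_ : NonZero b}} (x y : Var r) → (r , x) ∉ vars S → (r , y) ∉ vars S →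
    Valid k (⟨ b ∶ P ⟩ S ⟨ e ∶ Q ⟩) → Valid k (⟨ b ∶ P [ free y / x ] ⟩ S ⟨ e ∶ Q [ free y / x ] ⟩)
  valid-R9 {b = b} {P = P} {Q} S {r} x y x∉S y∉S (b≤ , s) = b≤ , λ v p →
    Safe-simulate-⟦⟧ (pred b) S sim ((λ z x≢z → update-other x z x≢z) , update-same x)
      (λ { {w = w} (v≈w , vx≡wy) (e≡ , q) →
        e≡ , to (Sat-[/] {v = w} Q (free y) x) (to (Sat-agree Q λ z _ → transfer z v≈w vx≡wy) q) })
      (s (update x (v r y) v) (from (Sat-[/] {v = v} P (free y) x) p))
    where
    open Simulation (sameExcept-simulation x x∉S)

    sim : Simulation (vars S) (λ v w → SameExcept x v w × v r x ≡ w r y)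
    sim = record
      { same   = λ f∈S (v≈w , _) → same f∈S v≈w
      ; stable = λ { {f = f} a f∈S (v≈w , vx≡wy) →
          stable a f∈S v≈w ,
          trans (update-other {serv} f x λ { refl → x∉S f∈S })
            (trans vx≡wy (sym (update-other {serv} f y λ { refl → y∉S f∈S }))) }
      }

    transfer : ∀ {v w a s} (z : Var s) → SameExcept x v w → v r x ≡ a → v s z ≡ update x a w s z
    transfer {s = s} z v≈w vx≡a with (r , x) ≟ (s , z)
    ... | yes refl = vx≡a
    ... | no  x≢z  = v≈w z x≢z

  valid-R10 : ∀ {k b e P P′ Q Q′} S .{{_ : NonZero b}} → 𝔄 ⊨ P ⇒ P′ →
    Valid k (⟨ b ∶ P′ ⟩ S ⟨ e ∶ Q′ ⟩) → 𝔄 ⊨ Q′ ⇒ Q → Valid k (⟨ b ∶ P ⟩ S ⟨ e ∶ Q ⟩)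
  valid-R10 {b = b} S h (b≤ , s) h′ = b≤ , λ v p →
    Safe-map (advance (pred b) (just ⟦ S ⟧)) (λ { {w = w} (e≡ , q) → e≡ , h′ w q }) (s v (h v p))

  -- Soundness of derivations

  -- Stands in for the subterm order: by size, a hypothesis about `S ^ω` cannot occur in a
  -- derivation for `S`, nor one about `T` directly yield an assertion about `S ⨾ T`.
  termSize : 𝒯 → ℕ
  termSize ⟨ u ⟩   = 1
  termSize (S ⨾ T) = suc (termSize S + termSize T)
  termSize (S ^ω)  = suc (termSize S)

  termSize-⨾ˡ : ∀ S T → termSize S < termSize (S ⨾ T)
  termSize-⨾ˡ S T = s≤s (m≤m+n _ _)

  termSize-⨾ʳ : ∀ S T → termSize T < termSize (S ⨾ T)
  termSize-⨾ʳ S T = s≤s (m≤n+m _ _)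

  -- An assertion about S with entry point b can be derived without R5 only
  -- from hypotheses about T with entry point c such that (c , T) ≼ (b , S).
  infix 4 _≼_

  _≼_ : ℕ × 𝒯 → ℕ × 𝒯 → Set
  (c , T) ≼ (b , S) = (c ≡ b × T ≡ S) ⊎ termSize T < termSize S

  ≼-smaller : ∀ {a b c S T U} → termSize T < termSize U → (a , S) ≼ (b , T) → (a , S) ≼ (c , U)
  ≼-smaller T<U (inj₁ (_ , refl)) = inj₂ T<U
  ≼-smaller T<U (inj₂ S<T)        = inj₂ (<-trans S<T T<U)

  ≼-impossible : ∀ {b c S T U} → T ≡ U → termSize S < termSize U → ¬ (c , T) ≼ (b , S)
  ≼-impossible refl S<T (inj₁ (_ , refl)) = <-irrefl refl S<T
  ≼-impossible refl S<T (inj₂ T<S)        = <-irrefl refl (<-trans S<T T<S)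

  len-positive : ∀ S {n} → len S ≡ finite n → 0 < n
  len-positive S eq with ⟦ S ⟧
  len-positive S refl | fin (x ∷ xs) = s≤s z≤n

  -- Well-founded induction on the fuel, with one on the entry point nested inside. Less fuel allows
  -- every index, whatever its entry point.
  lexicographic : ∀ {I : Set} (b : I → ℕ) (V : ℕ → I → Set) →
    (∀ k j → (∀ i {k′} → k′ < k ⊎ (k′ ≤ k × b i < b j) → V k′ i) → V k j) →
    ∀ k j → V k j
  lexicographic b V h = <-rec (λ k → ∀ j → V k j) λ k outer j →
    <-rec (λ m → ∀ i → b i ≡ m → V k i)
      (λ { _ inner i refl → h k i λ where
        i′ (inj₁ k′<k)           → outer k′<k i′
        i′ (inj₂ (k′≤k , bi<bj)) → [ (λ k′<k → outer k′<k i′) , (λ { refl → inner bi<bj i′ refl }) ]′ (m≤n⇒m<n∨m≡n k′≤k) })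
      (b j) j refl

  FormulasHold : Pred Hypothesis 0ℓ → Set
  FormulasHold Γ = ∀ {P} → Γ (formula P) → 𝔄 ⊨ P

  -- `C` delimits the uses that a derivation can make of a hypothesis, so validity is demanded only
  -- for the entry points, terms and fuels that actually arise.
  HypothesesValid : Pred Hypothesis 0ℓ → (ℕ → 𝒯 → ℕ → Set) → Set
  HypothesesValid Γ C = ∀ {c P T e Q j} .{{_ : NonZero c}} →
    Γ (asserted (⟨ c ∶ P ⟩ T ⟨ e ∶ Q ⟩)) → C c T j → Valid j (⟨ c ∶ P ⟩ T ⟨ e ∶ Q ⟩)

  -- The hypotheses about T = S ^ω in a derivation for S ⨾ T are needed only
  -- with less fuel (below R1) or for an earlier entry point (below R4), which
  -- is what makes R5 sound by lexicographic induction.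
  mutual
    sound : ∀ {Γ μ b P S e Q} .{{_ : NonZero b}} → Γ ⊢[ μ ] ⟨ b ∶ P ⟩ S ⟨ e ∶ Q ⟩ → FormulasHold Γ →
      (μ ≡ full → ∀ {ψ} → ¬ Γ (asserted ψ)) →
      ∀ k → HypothesesValid Γ (λ c T j → (c , T) ≼ (b , S) × j ≤ k) →
      Valid k (⟨ b ∶ P ⟩ S ⟨ e ∶ Q ⟩)
    sound (hyp γ) F N k H = H γ (inj₁ (refl , refl) , ≤-refl)
    sound A1  F N k H = valid-A1 k
    sound (A2 {f = f} {m}) F N k H = valid-𝖽 k (plain (f ∙ m)) refl
    sound (A3 {f = f} {m}) F N k H = valid-𝗍 k (pos (f ∙ m)) refl
    sound (A4 {f = f} {m}) F N k H = valid-𝖿 k (pos (f ∙ m)) refl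
    sound (A5 {f = f} {m}) F N k H = valid-𝖽 k (pos (f ∙ m)) refl
    sound (A6 {f = f} {m}) F N k H = valid-𝗍 k (neg (f ∙ m)) refl
    sound (A7 {f = f} {m}) F N k H = valid-𝖿 k (neg (f ∙ m)) refl
    sound (A8 {f = f} {m}) F N k H = valid-𝖽 k (neg (f ∙ m)) refl
    sound A9  F N k H = valid-A9 k
    sound A10 F N k H = valid-A10 k
    sound A11 F N k H = valid-A11 k
    sound (R1 {S₁ = S₁} {S₂} d₁ d₂) F N k H =
      valid-R1 S₁ S₂
        (sound d₁ F N k λ γ (below , j≤k) → H γ (≼-smaller (termSize-⨾ˡ S₁ S₂) below , j≤k))
        (λ j<k → sound d₂ F N _ λ γ (below , i≤j) →
          H γ (≼-smaller (termSize-⨾ʳ S₁ S₂) below , ≤-trans i≤j (<⇒≤ j<k)))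
    sound (R2 {S₁ = S₁} {S₂} len≡ d) F N k H =
      valid-R2 S₁ S₂ len≡ (sound d F N k λ γ (below , j≤k) → H γ (≼-smaller (termSize-⨾ˡ S₁ S₂) below , j≤k))
    sound (R3 {S₁ = S₁} {S₂} d) F N k H =
      valid-R3 S₁ S₂ (sound d F N k λ γ (below , j≤k) → H γ (≼-smaller (termSize-⨾ˡ S₁ S₂) below , j≤k))
    sound (R4 {S₁ = S₁} {S₂} len≡ d) F N k H =
      valid-R4 S₁ S₂ len≡ (sound d F N k λ γ (below , j≤k) → H γ (≼-smaller (termSize-⨾ʳ S₁ S₂) below , j≤k))
    sound (R5 {S = S} b P Q d j) F N k H =
      lexicographic b (λ k j → Valid k (⟨ b j ∶ P j ⟩ S ^ω ⟨ 0 ∶ Q j ⟩))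
        (λ k j ih → valid-fold S
          -- R5 exists in full mode only, where by `N` the context `Γ` contains no assertions; so
          -- all assertions available to `d j` are among those added by the rule, and `ih` covers
          -- them.
          (sound-unfolding (d j)
            (λ { (inj₁ γ) → F γ ; (inj₂ (_ , ())) })
            (λ { (inj₁ γ) → contradiction γ (N refl) ; (inj₂ (_ , refl)) → refl })
            ≤-refl k
            (λ { (inj₁ γ) _ → contradiction γ (N refl) ; (inj₂ (i , refl)) → ih i })))
        k j
    sound (R6 {S = S} d₁ d₂) F N k H = valid-R6 S (sound d₁ F N k H) (sound d₂ F N k H)
    sound (R7 {R = R} {S} disjoint d) F N k H = valid-R7 R S disjoint (sound d F N k H)
    sound (R8 {S = S} x x∉S x∉Q d) F N k H = valid-R8 S x x∉S x∉Q (sound d F N k H)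
    sound (R9 {S = S} x y x∉S y∉S d) F N k H = valid-R9 S x y x∉S y∉S (sound d F N k H)
    sound (R10 {S = S} γ d γ′) F N k H = valid-R10 S (F γ) (sound d F N k H) (F γ′)

    sound-unfolding : ∀ {Γ b e P Q S T} .{{_ : NonZero b}} →
      Γ ⊢[ noR5 ] ⟨ b ∶ P ⟩ S ⨾ T ⟨ e ∶ Q ⟩ → FormulasHold Γ →
      (∀ {c P U e Q} .{{_ : NonZero c}} → Γ (asserted (⟨ c ∶ P ⟩ U ⟨ e ∶ Q ⟩)) → U ≡ T) → termSize S < termSize T →
      ∀ k → HypothesesValid Γ (λ c _ j → j < k ⊎ (j ≤ k × c < b)) →
      Valid k (⟨ b ∶ P ⟩ S ⨾ T ⟨ e ∶ Q ⟩)
    sound-unfolding {S = S} {T} (hyp γ) F B S<T k H =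
      -- A hypothesis used directly would make `T` equal to `S ⨾ T`.
      ⊥-elim (<-irrefl (cong termSize (sym (B γ))) (termSize-⨾ʳ S T))
    sound-unfolding (R1 {S₁ = S} {T} d₁ d₂) F B S<T k H =
      valid-R1 S T
        -- All asserted hypotheses are about `T`, which is larger than `S`; none is usable for `S`.
        (sound d₁ F (λ ()) k λ γ (below , _) → ⊥-elim (≼-impossible (B γ) S<T below))
        (λ j<k → sound d₂ F (λ ()) _ λ γ (_ , i≤j) → H γ (inj₁ (≤-<-trans i≤j j<k)))
    sound-unfolding (R2 {S₁ = S} {T} len≡ d) F B S<T k H =
      valid-R2 S T len≡ (sound d F (λ ()) k λ γ (below , _) → ⊥-elim (≼-impossible (B γ) S<T below))
    sound-unfolding (R3 {S₁ = S} {T} d) F B S<T k H =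
      valid-R3 S T (sound d F (λ ()) k λ γ (below , _) → ⊥-elim (≼-impossible (B γ) S<T below))
    sound-unfolding (R4 {b = b} {S₁ = S} {T} len≡ d) F B S<T k H =
      valid-R4 S T len≡ (sound d F (λ ()) k λ where
        -- The hypothesis is used at entry `b` with the conclusion at `b + n`: the entry point
        -- decreases strictly because `S` is nonempty.
        γ (inj₁ (refl , _) , j≤k) → H γ (inj₂ (j≤k , m<m+n b (len-positive S len≡)))
        γ (inj₂ U<T , _)          → ⊥-elim (<-irrefl (cong termSize (B γ)) U<T))
    sound-unfolding (R6 {S = S} d₁ d₂) F B S<T k H =
      valid-R6 S (sound-unfolding d₁ F B S<T k H) (sound-unfolding d₂ F B S<T k H)
    sound-unfolding (R7 {R = R} {S} disjoint d) F B S<T k H =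
      valid-R7 R S disjoint (sound-unfolding d F B S<T k H)
    sound-unfolding (R8 {S = S} x x∉S x∉Q d) F B S<T k H =
      valid-R8 S x x∉S x∉Q (sound-unfolding d F B S<T k H)
    sound-unfolding (R9 {S = S} x y x∉S y∉S d) F B S<T k H =
      valid-R9 S x y x∉S y∉S (sound-unfolding d F B S<T k H)
    sound-unfolding (R10 {S = S} γ d γ′) F B S<T k H =
      valid-R10 S (F γ) (sound-unfolding d F B S<T k H) (F γ′)

  -- Services of a service family

  both-cong : ∀ x x′ y y′ → Maybe.map value x ≡ Maybe.map value x′ → Maybe.map value y ≡ Maybe.map value y′ →
    Maybe.map value (both x y) ≡ Maybe.map value (both x′ y′)
  both-cong nothing  nothing  y        y′       p q = q
  both-cong (just _) (just _) nothing  nothing  p q = p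
  both-cong (just _) (just _) (just _) (just _) p q = refl

  both-identityʳ : ∀ x → both x nothing ≡ x
  both-identityʳ nothing  = refl
  both-identityʳ (just _) = refl

  both-comm : ∀ x y → both x y ≡ both y x
  both-comm nothing  nothing  = refl
  both-comm nothing  (just _) = refl
  both-comm (just _) nothing  = refl
  both-comm (just _) (just _) = refl

  both-assoc : ∀ x y z → both (both x y) z ≡ both x (both y z)
  both-assoc nothing  y        z        = refl
  both-assoc (just _) nothing  z        = refl
  both-assoc (just _) (just _) nothing  = refl
  both-assoc (just _) (just _) (just _) = refl

  -- By `∙-cong`, the free extension identifies services with equal values, so only the value of a
  -- service is invariant, not the term denoting it.
  service-≈ : ∀ {u v} → u ≈ v → ∀ f → Maybe.map value (service f u) ≡ Maybe.map value (service f v)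
  service-≈ ≈-refl        f = refl
  service-≈ (≈-sym p)     f = sym (service-≈ p f)
  service-≈ (≈-trans p q) f = trans (service-≈ p f) (service-≈ q f)
  service-≈ (∙-cong {g} s≡s′) f with f ≟ᶠ g
  ... | yes _ = cong just s≡s′
  ... | no  _ = refl
  service-≈ (⊕-cong {u} {u′} {v} {v′} p q) f =
    both-cong (service f u) (service f u′) (service f v) (service f v′) (service-≈ p f) (service-≈ q f)
  service-≈ (∂-cong {F} p) f with F f
  ... | true  = refl
  ... | false = service-≈ p f
  service-≈ (⊕-∅ {u})             f = cong (Maybe.map value) (both-identityʳ (service f u))
  service-≈ (⊕-comm {u} {v})      f = cong (Maybe.map value) (both-comm (service f u) (service f v))
  service-≈ (⊕-assoc {u} {v} {w}) f = cong (Maybe.map value) (both-assoc (service f u) (service f v) (service f w))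
  service-≈ (⊕-clash {g}) f with f ≟ᶠ g
  ... | yes _ = refl
  ... | no  _ = refl
  service-≈ (∂-∅ {F}) f with F f
  ... | true  = refl
  ... | false = refl
  service-≈ (∂-in {F} {g} Fg) f with f ≟ᶠ g
  ... | yes refl rewrite Fg = refl
  ... | no  _ with F f
  ...   | true  = refl
  ...   | false = refl
  service-≈ (∂-out {F} {g} Fg) f with f ≟ᶠ g
  ... | yes refl rewrite Fg = refl
  ... | no  _ with F f
  ...   | true  = refl
  ...   | false = refl
  service-≈ (∂-⊕ {F}) f with F f
  ... | true  = refl
  ... | false = refl

  overlay-≈ : ∀ {t u v s} → t ≈ u → (x : Var s) → overlay t v s x ≡ overlay u v s x
  overlay-≈ {t} {u} {s = serv}    p f with service f t | service f u | service-≈ p f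
  ... | nothing | nothing | _    = refl
  ... | just _  | just _  | eq   = just-injective eq
  overlay-≈ {s = repl}    p x = refl
  overlay-≈ {s = extra i} p x = refl

  stepped : Focus → Method → Closed serv → SF → SF
  stepped f m c t = f ∙ op (∂ m) (c ∷ []) ⊕ encap ｛ f ｝ t

  service-stepped-same : ∀ f {m c t} → service f (stepped f m c t) ≡ just (op (∂ m) (c ∷ []))
  service-stepped-same f with f ≟ᶠ f
  ... | yes _  = refl
  ... | no f≢f = contradiction refl f≢f

  service-stepped-other : ∀ {f} g {m c t} → f ≢ g → service g (stepped f m c t) ≡ service g t
  service-stepped-other {f} g f≢g with g ≟ᶠ f | f ≟ᶠ g
  ... | yes refl | _       = contradiction refl f≢g
  ... | no _     | yes f≡g = contradiction f≡g f≢g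
  ... | no _     | no _    = refl

  -- The valuation of a run and the state to which the thread is applied correspond; `v₀` fixes the
  -- variables about which the state says nothing.
  Matches : Valuation → Valuation → SF → Set
  Matches v₀ v t = ∀ {s} (x : Var s) → v s x ≡ overlay t v₀ s x

  matches-service : ∀ {v₀ v t c} f → Matches v₀ v t → service f t ≡ just c → v serv f ≡ value c
  matches-service {v₀} f v~t eq = trans (v~t {serv} f) (cong (Maybe.maybe′ value (v₀ serv f)) eq)

  matches-derived : ∀ {v₀ v t c} f m → Matches v₀ v t → service f t ≡ just c →
    Matches v₀ (derived f m v) (stepped f m c t)
  matches-derived {v₀} {v} {t} {c} f m v~t eq {serv} g = at (f ≟ᶠ g)
    where
    at : Dec (f ≡ g) → derived f m v serv g ≡ overlay (stepped f m c t) v₀ serv g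
    at (yes refl) = trans (update-same {serv} f)
      (trans (cong (∂ᴬ m) (matches-service {t = t} f v~t eq))
        (cong (Maybe.maybe′ value (v₀ serv f)) (sym (service-stepped-same f {m} {c} {t}))))
    at (no f≢g) = trans (update-other {serv} f {v = v} g λ { refl → f≢g refl })
      (trans (v~t {serv} g)
        (cong (Maybe.maybe′ value (v₀ serv g)) (sym (service-stepped-other g {m} {c} {t} f≢g))))
  matches-derived {v = v} f m v~t eq {repl}    x = trans (update-other {serv} f {∂ᴬ m (v serv f)} {v} x λ ()) (v~t x)
  matches-derived {v = v} f m v~t eq {extra i} x = trans (update-other {serv} f {∂ᴬ m (v serv f)} {v} x λ ()) (v~t x)

  -- Extracted threads and execution

  respond : Focus → Method → FinThread → FinThread → SF → Maybe (Closed serv) → SF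
  respond f m x y t nothing  = ∅
  respond f m x y t (just c) = choose (reply m (value c)) (x • stepped f m c t) (y • stepped f m c t) ∅

  •-respond : ∀ f m x y t → (x ⊴ f ∙ m ⊵ y) • t ≡ respond f m x y t (service f t)
  •-respond f m x y t with service f t
  ... | nothing = refl
  ... | just c with ρᴬ m (value c) ≟ʳ tᴬ | ρᴬ m (value c) ≟ʳ fᴬ
  ...   | yes _ | _     = refl
  ...   | no _  | yes _ = refl
  ...   | no _  | no _  = refl

  settleBy : ℕ → Kind → Seq → Maybe Seq
  settleBy zero    (jmp l) X = nothing
  settleBy (suc k) (jmp l) X = jump l (rest X) >>= settle k
  settleBy k       _       X = just X

  settle-kind : ∀ k X → settle k X ≡ settleBy k (kind (first X)) X
  settle-kind k X with first X | k
  ... | plain _ | zero  = refl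
  ... | plain _ | suc _ = refl
  ... | pos _   | zero  = refl
  ... | pos _   | suc _ = refl
  ... | neg _   | zero  = refl
  ... | neg _   | suc _ = refl
  ... | # _     | zero  = refl
  ... | # _     | suc _ = refl
  ... | !       | zero  = refl
  ... | !       | suc _ = refl

  performBy : ℕ → Kind → Maybe Seq → FinThread
  performBy n (test a i j) mX = extract n (toMaybe (advance i mX)) ⊴ a ⊵ extract n (toMaybe (advance j mX))
  performBy n (jmp _)      mX = 𝐃
  performBy n stop         mX = 𝐒

  toMaybe-advance-zero : ∀ mX → toMaybe (advance 0 mX) ≡ mX
  toMaybe-advance-zero nothing  = refl
  toMaybe-advance-zero (just X) = refl

  perform-kind : ∀ n u mX → perform n u mX ≡ performBy n (kind u) mX
  perform-kind n (plain a) mX rewrite toMaybe-advance-zero mX = refl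
  perform-kind n (pos a)   mX rewrite toMaybe-advance-zero mX | jump-advance 1 mX = refl
  perform-kind n (neg a)   mX rewrite toMaybe-advance-zero mX | jump-advance 1 mX = refl
  perform-kind n (# l)     mX = refl
  perform-kind n !         mX = refl

  -- A projection depth counts actions, whereas fuel is also spent on jumps. Safety for all fuels
  -- avoids relating the two.
  AllSafe : Pos → Valuation → Post → Set
  AllSafe p v Φ = ∀ k → Safe k p v Φ

  AllSafe-step : ∀ {X v Φ κ} → kind (first X) ≡ κ → AllSafe (inside X) v Φ →
    ∀ k → SafeAfter k (rest X) v Φ (exec κ v)
  AllSafe-step refl s k = s (suc k)

  -- Jumps leave the valuation unchanged, and the fuel they cost is immaterial under `AllSafe`.
  settle-safe : ∀ {v Φ Y} k X → settle k X ≡ just Y → AllSafe (inside X) v Φ → AllSafe (inside Y) v Φ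
  settle-safe k X eq s rewrite settle-kind k X with kind (first X) in κ≡ | k | eq
  ... | test a i j  | zero  | refl = s
  ... | test a i j  | suc _ | refl = s
  ... | stop        | zero  | refl = s
  ... | stop        | suc _ | refl = s
  ... | jmp (suc l) | suc k | eq′
    with s′ ← AllSafe-step κ≡ s
    rewrite jump-advance l (rest X) with advance l (rest X)
  ...   | inside X′ = settle-safe k X′ eq′ s′

  Outcome : Valuation → Post → SF → Set
  Outcome v₀ Φ u = u ≡ ∅ ⊎ ∃ λ v → Φ 0 v × Matches v₀ v u

  module _ {v₀ : Valuation} {Φ : Post} where
    mutual
      extract-outcome : ∀ n p {v t} → AllSafe p v Φ → Matches v₀ v t → Outcome v₀ Φ (extract n (toMaybe p) • t)
      extract-outcome zero    p           s v~t = inj₁ refl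
      extract-outcome (suc n) (outside l) s v~t = inj₁ refl
      extract-outcome (suc n) (inside X)  s v~t with settle (size X) X in eq
      ... | nothing = inj₁ refl
      ... | just Y rewrite perform-kind n (first Y) (rest Y) =
        perform-outcome n (kind (first Y)) (rest Y) (AllSafe-step refl (settle-safe (size X) X eq s)) v~t

      perform-outcome : ∀ n κ mX {v t} → (∀ k → SafeAfter k mX v Φ (exec κ v)) → Matches v₀ v t →
        Outcome v₀ Φ (performBy n κ mX • t)
      perform-outcome n (jmp l) mX s v~t = inj₁ refl
      perform-outcome n stop    mX s v~t = inj₂ (_ , s 0 , v~t)
      perform-outcome n (test (f ∙ m) i j) mX {v} {t} s v~t
        rewrite •-respond f m (extract n (toMaybe (advance i mX))) (extract n (toMaybe (advance j mX))) t
        with service f t in eq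
      ... | nothing = inj₁ refl
      ... | just c
        with v~t′ ← (λ {s} → matches-derived {t = t} f m v~t eq {s})
        rewrite sym (matches-service {t = t} f v~t eq)
        with reply m (v serv f)
      ...   | just true  = extract-outcome n (advance i mX) s v~t′
      ...   | just false = extract-outcome n (advance j mX) s v~t′
      ...   | nothing    = inj₁ refl

  advance-fin : ∀ l x xs {Y} → advance l (rest (fin (x ∷ xs))) ≡ inside Y →
    ∃ λ ys → Y ≡ fin ys × List⁺.length ys ≤ length xs
  advance-fin zero    x (y ∷ ys) refl = y ∷ ys , refl , ≤-refl
  advance-fin (suc l) x (y ∷ ys) eq   =
    let zs , Y≡ , zs≤ = advance-fin l y ys eq in zs , Y≡ , ≤-trans zs≤ (n≤1+n _)

  -- Chains of jumps in a finite sequence go forward, so both fuels suffice.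
  settle-extend : ∀ {v Φ} → (∀ {l w} → ¬ Φ (suc l) w) → ∀ k k′ xs Z →
    List⁺.length xs ≤ k → List⁺.length xs ≤ k′ → AllSafe (inside (fin xs)) v Φ →
    (settle k (fin xs) ≡ nothing × settle k′ (fin xs ++ˢ Z) ≡ nothing) ⊎
    (∃ λ Y → settle k (fin xs) ≡ just Y × settle k′ (fin xs ++ˢ Z) ≡ just (Y ++ˢ Z) × AllSafe (inside Y) v Φ)
  settle-extend ¬Φ (suc k) (suc k′) xs@(x ∷ xs′) Z (s≤s n≤k) (s≤s n≤k′) s
    rewrite settle-kind (suc k) (fin xs) | settle-kind (suc k′) (fin xs ++ˢ Z) | first-++ˢ (fin xs) Z
    with kind x in κ≡
  ... | test a i j = inj₂ (_ , refl , refl , s)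
  ... | stop       = inj₂ (_ , refl , refl , s)
  ... | jmp zero   = inj₁ (refl , refl)
  ... | jmp (suc l)
    with s′ ← AllSafe-step κ≡ s
    rewrite jump-advance l (rest (fin xs)) | jump-advance l (rest (fin xs ++ˢ Z)) | advance-rest-++ˢ l (fin xs) Z
    with advance l (rest (fin xs)) in eq
  -- A jump out of `xs` would land in `Z` or beyond once `Z` is appended; `Φ` rules such an exit
  -- out.
  ...   | outside _ = ⊥-elim (¬Φ (s′ 0))
  ...   | inside Y with ys , refl , ys≤ ← advance-fin l x xs′ eq =
    settle-extend ¬Φ k k′ ys Z (≤-trans ys≤ n≤k) (≤-trans ys≤ n≤k′) s′

  length≤size-++ˢ : ∀ xs Z → List⁺.length xs ≤ size (fin xs ++ˢ Z)
  length≤size-++ˢ xs       (fin zs)      rewrite length-⁺++⁺ xs zs = m≤m+n _ _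
  length≤size-++ˢ (x ∷ xs) (lasso us vs) rewrite length-++ xs {us} =
    s≤s (≤-trans (m≤m+n _ (length us)) (m≤m+n _ _))

  module _ {v₀ : Valuation} {Φ : Post} (¬Φ : ∀ {l w} → ¬ Φ (suc l) w) where
    mutual
      -- As `Φ` admits no positive exit, execution never reaches the appended `Z`.
      extract-extend : ∀ n p Z {v t} → AllSafe p v Φ → Matches v₀ v t →
        extract n (toMaybe (andThen p Z)) • t ≡ extract n (toMaybe p) • t
      extract-extend zero    p                     Z s v~t = refl
      extract-extend (suc n) (outside l)           Z s v~t = ⊥-elim (¬Φ (s 0))
      -- An infinite sequence absorbs whatever is appended to it.
      extract-extend (suc n) (inside (lasso us vs)) Z s v~t = refl
      extract-extend (suc n) (inside (fin xs))     Z s v~t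
        with settle-extend {Φ = Φ} ¬Φ (size (fin xs)) (size (fin xs ++ˢ Z)) xs Z ≤-refl (length≤size-++ˢ xs Z) s
      ... | inj₁ (eq , eq′) rewrite eq | eq′ = refl
      ... | inj₂ (Y , eq , eq′ , s′)
        rewrite eq | eq′ | perform-kind n (first Y) (rest Y)
              | perform-kind n (first (Y ++ˢ Z)) (rest (Y ++ˢ Z)) | first-++ˢ Y Z =
        perform-extend n (kind (first Y)) Y Z (AllSafe-step refl s′) v~t

      perform-extend : ∀ n κ Y Z {v t} → (∀ k → SafeAfter k (rest Y) v Φ (exec κ v)) → Matches v₀ v t →
        performBy n κ (rest (Y ++ˢ Z)) • t ≡ performBy n κ (rest Y) • t
      perform-extend n (jmp l) Y Z s v~t = refl
      perform-extend n stop    Y Z s v~t = refl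
      perform-extend n (test (f ∙ m) i j) Y Z {v} {t} s v~t
        rewrite advance-rest-++ˢ i Y Z | advance-rest-++ˢ j Y Z
              | •-respond f m (extract n (toMaybe (andThen (advance i (rest Y)) Z)))
                              (extract n (toMaybe (andThen (advance j (rest Y)) Z))) t
              | •-respond f m (extract n (toMaybe (advance i (rest Y)))) (extract n (toMaybe (advance j (rest Y)))) t
        with service f t in eq
      ... | nothing = refl
      ... | just c
        with v~t′ ← (λ {s} → matches-derived {t = t} f m v~t eq {s})
        rewrite sym (matches-service {t = t} f v~t eq)
        with reply m (v serv f)
      ...   | just true  = extract-extend n (advance i (rest Y)) Z s v~t′
      ...   | just false = extract-extend n (advance j (rest Y)) Z s v~t′
      ...   | nothing    = refl

  -- Entry jumps, exit sequences and the final theorem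

  Safe-# : ∀ {v Φ} l X → AllSafe (advance l (just X)) v Φ → AllSafe (inside (⟦ ⟨ # (suc l) ⟩ ⟧ ++ˢ X)) v Φ
  Safe-# l X s zero = tt
  Safe-# l X s (suc k)
    rewrite first-++ˢ ⟦ ⟨ # (suc l) ⟩ ⟧ X | rest-++ˢ ⟦ ⟨ # (suc l) ⟩ ⟧ X = s k

  -- The sequence consists of `e` copies of `# 0` followed by `!`. An entry `l` below `e` gets
  -- stuck, one beyond `e` leaves through a positive exit, and only `l ≡ e` terminates.
  Safe-σ : ∀ {v} {Φ : Valuation → Set} k l e → (l ≡ e → Φ v) →
    Safe k (advance l (just ⟦ σ[1+ e ] ⟧)) v (λ o w → o ≡ 0 → Φ w)
  Safe-σ zero    zero    zero    h = tt
  Safe-σ (suc k) zero    zero    h = λ _ → h refl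
  Safe-σ k       (suc l) zero    h = λ ()
  Safe-σ zero    zero    (suc e) h = tt
  Safe-σ (suc k) zero    (suc e) h rewrite first-++ˢ ⟦ ⟨ # 0 ⟩ ⟧ ⟦ σ[1+ e ] ⟧ = tt
  Safe-σ k       (suc l) (suc e) h rewrite rest-++ˢ ⟦ ⟨ # 0 ⟩ ⟧ ⟦ σ[1+ e ] ⟧ =
    Safe-σ k l e (λ l≡e → h (cong suc l≡e))

  ++ˢ-assoc-singleton : ∀ u X Z → fin (u ∷ []) ++ˢ (X ++ˢ Z) ≡ (fin (u ∷ []) ++ˢ X) ++ˢ Z
  ++ˢ-assoc-singleton u (fin (x ∷ xs)) (fin (z ∷ zs)) = refl
  ++ˢ-assoc-singleton u (fin (x ∷ xs)) (lasso us vs)  = refl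
  ++ˢ-assoc-singleton u (lasso us vs)  Z              = refl

  module _ {e : ℕ} {Q : Formula} {v₀ v : Valuation} {t : SF} (l : ℕ) (S : 𝒯) (b≤ : suc l ≤ᴸ lenˢ ⟦ S ⟧)
           (s : AllSafe (advance l (just ⟦ S ⟧)) v (Ends e Q)) (v~t : Matches v₀ v t) where

    -- Termination happens either inside `S`, which is the case `e ≡ 0`, or at the `!` of the
    -- appended exit sequence, which exit `e` reaches only if `e ≡ e′`.
    TerminatesBy : ℕ → Post
    TerminatesBy e′ o w = o ≡ 0 → (e ≡ 0 ⊎ e ≡ e′) × Sat w [] Q

    exit-outcome : ∀ e′ n → Outcome v₀ (TerminatesBy e′) (approx ∣ S ∣[ suc l , e′ ] n • t)
    exit-outcome zero n = extract-outcome {Φ = TerminatesBy 0} n (inside _)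
      (Safe-# l ⟦ S ⟧ λ k → Safe-map (advance l (just ⟦ S ⟧)) (λ { (refl , q) refl → inj₁ refl , q }) (s k)) v~t
    exit-outcome (suc e′) n = extract-outcome {Φ = TerminatesBy (suc e′)} n (inside _)
      (Safe-# l (⟦ S ⟧ ++ˢ ⟦ σ[1+ e′ ] ⟧) λ k →
        Safe-enter l ⟦ S ⟧ ⟦ σ[1+ e′ ] ⟧ b≤
          (λ { (refl , q) _ → inj₁ refl , q })
          (λ { {j} {l′} _ (refl , q) → Safe-σ j l′ e′ (λ l′≡e′ → inj₂ (cong suc l′≡e′) , q) })
          (s k)) v~t

    -- With exit 0 every run that ends does so inside `S`, so the exit sequence after it is dead
    -- code.
    terminate-unaffected : e ≡ 0 → ∀ e′ n →
      approx ∣ S ∣[ suc l , suc e′ ] n • t ≡ approx ∣ S ∣[ suc l , 0 ] n • t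
    terminate-unaffected refl e′ n
      rewrite ++ˢ-assoc-singleton (# (suc l)) ⟦ S ⟧ ⟦ σ[1+ e′ ] ⟧ =
      extract-extend {v₀} {Ends 0 Q} (λ ()) n (inside _) ⟦ σ[1+ e′ ] ⟧ (Safe-# l ⟦ S ⟧ s) v~t

    onlyExit : OnlyExit 𝔄 S (suc l) t e
    -- `OnlyExit` is defined by cases on the exit, so the fixed `e` is generalised along with an
    -- equation.
    onlyExit = only e refl
      where
      only : ∀ x → e ≡ x → OnlyExit 𝔄 S (suc l) t x
      only zero    e≡0 zero     0≢0  u = contradiction refl 0≢0
      only zero    e≡0 (suc e′) _    u = mk⇔
        (λ (N , h) → N , λ n N≤n → subst (_≈ u) (terminate-unaffected e≡0 e′ n) (h n N≤n))
        (λ (N , h) → N , λ n N≤n → subst (_≈ u) (sym (terminate-unaffected e≡0 e′ n)) (h n N≤n))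
      only (suc x) refl e′ e′≢e = 0 , λ n _ → empty n (exit-outcome e′ n)
        where
        empty : ∀ n → Outcome v₀ (TerminatesBy e′) (approx ∣ S ∣[ suc l , e′ ] n • t) →
          approx ∣ S ∣[ suc l , e′ ] n • t ≈ ∅
        empty n (inj₁ r≡∅) = subst (_≈ ∅) (sym r≡∅) ≈-refl
        empty n (inj₂ (_ , h , _)) with proj₁ (h refl)
        ... | inj₂ e≡e′ = contradiction (sym e≡e′) e′≢e

    post : ∀ {t′} → ∣ S ∣[ suc l , e ] • t ≋ t′ → ¬ (t′ ≈ ∅) → Sat v₀ [] (Q [ t′ ])
    post {t′} (N , h) t′≉∅ with exit-outcome e N
    -- The projection at the threshold `N` already equals `t′`, so this case would make `t′` empty.
    ... | inj₁ r≡∅ = contradiction (≈-sym (subst (_≈ t′) r≡∅ (h N ≤-refl))) t′≉∅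
    ... | inj₂ (w , q , w~r) =
      to (Sat-instantiate Q t′)
        (to (Sat-agree Q λ x _ → trans (w~r x) (overlay-≈ (h N ≤-refl) x)) (proj₂ (q refl)))

  valid⇒holds : ∀ φ → (∀ k → Valid k φ) → Holds 𝔄 φ
  valid⇒holds (⟨ suc l ∶ P ⟩ S ⟨ e ∶ Q ⟩) valid =
    subst (suc l ≤ᴸ_) (sym (len≡lenˢ S)) b≤ , λ t t′ _ _ _ _ _ _ →
      -- `OnlyExit` mentions no valuation, so any default will do; one exists because the carriers
      -- are inhabited.
      (λ p → onlyExit l S b≤ (safe (λ s _ → inhabited s) t p) (λ _ → refl)) ,
      -- The valuation in which `Q [ t′ ]` is to be checked also serves as the default for
      -- `P [ t ]`, which holds in all valuations.
      (λ p r≋t′ t′≉∅ v₀ → post l S b≤ (safe v₀ t p) (λ _ → refl) r≋t′ t′≉∅)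
    where
    b≤ : suc l ≤ᴸ lenˢ ⟦ S ⟧
    b≤ = proj₁ (valid 0)

    safe : ∀ v₀ t → 𝔄 ⊨ P [ t ] → AllSafe (advance l (just ⟦ S ⟧)) (overlay t v₀) (Ends e Q)
    safe v₀ t p k = proj₂ (valid k) (overlay t v₀) (from (Sat-instantiate P t) (p v₀))

  soundness : ∀ φ → Th 𝔄 ⊢ φ → 𝔄 ⊨ᵃ φ
  soundness φ@(⟨ _ ∶ _ ⟩ _ ⟨ _ ∶ _ ⟩) d =
    valid⇒holds φ λ k → sound d (λ p → p) (λ _ ()) k (λ ())

theorem2 : (Focus Method : Set) (_≟ᶠ_ : DecidableEquality Focus) (Sg : Signature) →
    let open Logic Focus Method _≟ᶠ_ Sg in
    (𝔄 : ServiceAlgebra) (φ : Asserted) →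
    Th 𝔄 ⊢ φ → 𝔄 ⊨ᵃ φ
theorem2 = Soundness.soundness
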